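{- For each integer $n\ge 0$, let $a_n$ denote the number of tilings of an $8\times n$ board by $L$-tetrominoes (rotations allowed, reflections not allowed). Then the generating function is $\sum_{n\ge 0}a_nt^n=-A(t)/B(t)$, where \begin{align*} A(t) &= 4 t^{58}-5 t^{56}-69 t^{54}+34 t^{53}+36 t^{52}-28 t^{51}+334 t^{50}-194 t^{49}-181 t^{48}+196 t^{47}\\ &\qquad -560 t^{46} +356 t^{45}+490 t^{44}-396 t^{43}-22 t^{42}-114 t^{41}-240 t^{40}-44 t^{39}+1056 t^{38} \\ &\qquad -882 t^{37}-2511 t^{36} +1742 t^{35}-503 t^{34}+2046 t^{33}+9154 t^{32}-3982 t^{31}-2114 t^{30}\\ &\qquad -1838 t^{29}-16418 t^{28}+4992 t^{27} +4087 t^{26}+592 t^{25}+18004 t^{24}-3942 t^{23}-3377 t^{22}\\ &\qquad +80 t^{21}-12769 t^{20}+1978 t^{19}+1476 t^{18} -90 t^{17}+5910 t^{16}-602 t^{15}-344 t^{14}\\ &\qquad +20 t^{13} -1742 t^{12}+98 t^{11}+40 t^{10}-2 t^{9}+306 t^{8}-6 t^{7} -2 t^{6}-28 t^{4}+1 , \end{align*} and \begin{align*} B(t) &= 8 t^{62}-13 t^{60}-12 t^{59}-133 t^{58}+96 t^{57}+103 t^{56}+138 t^{55}+594 t^{54}-770 t^{53}-406 t^{52}\\ & \qquad -730 t^{51} -758 t^{50} +2786 t^{49}+820 t^{48}+2328 t^{47}-672 t^{46}-6010 t^{45}+118 t^{44}\\ &\qquad -5192 t^{43}+1900 t^{42}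 +7148 t^{41}-7274 t^{40}+9842 t^{39}+2695 t^{38}-3132 t^{37}\\ &\qquad +28144 t^{36}-16280 t^{35}-14647 t^{34} -854 t^{33}-59822 t^{32}+21412 t^{31}+24741 t^{30}\\ &\qquad -464 t^{29}+79992 t^{28}-20802 t^{27}-22589 t^{26} +2654 t^{25}-70203 t^{24}+14230 t^{23}\\ &\qquad +11727 t^{22}-1922 t^{21}+40915 t^{20}-6502 t^{19}-3185 t^{18} +498 t^{17}-15672 t^{16}\\ &\qquad +1834 t^{15}+278 t^{14}-10 t^{13}+3807 t^{12}-278 t^{11}+59 t^{10}-16 t^{9} -543 t^{8}+16 t^{7}\\ &\qquad -15 t^{6}+2 t^{5}+39 t^{4}+t^{2}-1. \end{align*} The first terms of the sequence $(a_n)_{n\ge 0}$ are $1, 0, 1, 0, 12, 2, 34, 14, 250, 114, 956, 694, 5864, 4428, 25805, 25554, \ldots$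
   Context: A $k\times n$ board is the rectangle of unit cells $\{(x,y)\in\mathbb{Z}^2: 0\le x<n,\ 0\le y<k\}$, where each cell is named by its bottom left corner. The $L$-tetromino tiles are the translates of the four sets (the rotations of the $L$-tetromino) \[\{(0,0),(0,1),(0,2),(1,0)\},\ \{(0,0),(0,1),(1,1),(2,1)\},\ \{(0,0),(1,0),(2,0),(2,1)\},\ \{(0,2),(1,0),(1,1),(1,2)\}.\] Reflections of these shapes are not allowed. A tiling of a board is a partition of its set of cells into such tiles (each tile may be used any number of times); two tilings are the same only if they are equal as partitions of the board (no identification under symmetries). The empty board ($n=0$) has exactly one tiling. Generating functions are formal power series in $t$ with rational coefficients. -}

module Defs where

open import Algebra.Definitions.RawMonoid using (sum)
open import Data.Bool.Base using (if_then_else_)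
open import Data.Fin.Base using (Fin; toℕ)
open import Data.Integer.Base as ℤ using (ℤ; +_; 0ℤ)
open import Data.List.Base using (List; []; _∷_; map)
open import Data.List.Membership.Propositional using (_∈_)
open import Data.List.Relation.Binary.BagAndSetEquality using (set; [_]-Equality)
open import Data.List.Relation.Binary.Disjoint.Propositional using (Disjoint)
open import Data.List.Relation.Binary.Subset.Setoid.Properties using (⊆-preorder)
open import Data.List.Relation.Unary.AllPairs using (AllPairs)
open import Data.List.Relation.Unary.Any using (Any)
open import Data.Nat.Base using (ℕ; zero; suc; _∸_; _≡ᵇ_)
open import Data.Product.Base using (_×_; _,_; ∃)
open import Data.Rational.Base as ℚ using (ℚ)
open import Function.Bundles using (_⇔_; Bijection)
open import Level using (0ℓ)
open import Relation.Binary.Bundles using (Setoid)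
import Relation.Binary.Construct.On as On
open import Relation.Binary.PropositionalEquality.Core using (_≗_)
open import Relation.Binary.PropositionalEquality.Properties using (setoid)
open import Relation.Binary.Properties.Preorder using (InducedEquivalence)

------------------------------------------------------------------------
-- Boards and tiles

Cell : Set
Cell = ℤ × ℤ

InBoard : ℕ → ℕ → Cell → Set
InBoard k n (x , y) = (0ℤ ℤ.≤ x × x ℤ.< + n) × (0ℤ ℤ.≤ y × y ℤ.< + k)

data Rotation : Set where
  r₀ r₁ r₂ r₃ : Rotation

shape : Rotation → List Cell
shape r₀ = (+ 0 , + 0) ∷ (+ 0 , + 1) ∷ (+ 0 , + 2) ∷ (+ 1 , + 0) ∷ []
shape r₁ = (+ 0 , + 0) ∷ (+ 0 , + 1) ∷ (+ 1 , + 1) ∷ (+ 2 , + 1) ∷ []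
shape r₂ = (+ 0 , + 0) ∷ (+ 1 , + 0) ∷ (+ 2 , + 0) ∷ (+ 2 , + 1) ∷ []
shape r₃ = (+ 0 , + 2) ∷ (+ 1 , + 0) ∷ (+ 1 , + 1) ∷ (+ 1 , + 2) ∷ []

translate : ℤ × ℤ → Cell → Cell
translate (u , v) (x , y) = (u ℤ.+ x , v ℤ.+ y)

record Tile : Set where
  constructor tile
  field
    rotation : Rotation
    offset   : ℤ × ℤ

  cells : List Cell
  cells = map (translate offset) (shape rotation)

open Tile public using (cells)

-- Tiles are compared as sets of cells.

tileSetoid : Setoid 0ℓ 0ℓ
tileSetoid = On.setoid ([ set ]-Equality Cell) cells

------------------------------------------------------------------------
-- Tilings

-- Tiles are nonempty, so the two conditions below say that the sets of
-- cells of the listed tiles partition the board; by disjointness no tile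
-- is listed twice.

record Tiling (k n : ℕ) : Set where
  field
    tiles    : List Tile
    disjoint : AllPairs (λ s t → Disjoint (cells s) (cells t)) tiles
    covers   : ∀ c → InBoard k n c ⇔ Any (λ t → c ∈ cells t) tiles

open Tiling public using (tiles)

-- The order in which the tiles are listed is irrelevant: two tilings are
-- equal when each set of cells occurring in one occurs in the other.

tilingSetoid : ℕ → ℕ → Setoid 0ℓ 0ℓ
tilingSetoid k n =
  On.setoid (InducedEquivalence (⊆-preorder tileSetoid)) (tiles {k} {n})

HasCardinality : Setoid 0ℓ 0ℓ → ℕ → Set
HasCardinality S m = Bijection (setoid (Fin m)) S

------------------------------------------------------------------------
-- Formal power series in t over ℚ, as coefficient sequences

PowerSeries : Set
PowerSeries = ℕ → ℚ

infixl 7 _⊛_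
infix  8 ⊝_
infix  4 _≈_/_

𝟏 : PowerSeries
𝟏 zero    = ℚ.1ℚ
𝟏 (suc _) = ℚ.0ℚ

⊝_ : PowerSeries → PowerSeries
(⊝ F) n = ℚ.- F n

_⊛_ : PowerSeries → PowerSeries → PowerSeries
(F ⊛ G) n = sum ℚ.+-0-rawMonoid {suc n} (λ i → F (toℕ i) ℚ.* G (n ∸ toℕ i))

-- F ≈ P / Q: the series Q is invertible and F is P times its inverse.

_≈_/_ : PowerSeries → PowerSeries → PowerSeries → Set
F ≈ P / Q = ∃ λ Q⁻¹ → (Q ⊛ Q⁻¹ ≗ 𝟏) × (F ≗ P ⊛ Q⁻¹)

generatingFunction : (ℕ → ℕ) → PowerSeries
generatingFunction a n = + a n ℚ./ 1

------------------------------------------------------------------------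
-- Integer polynomials in t, as lists of terms (coefficient , exponent)

Polynomial : Set
Polynomial = List (ℤ × ℕ)

infixl 6 _⊕_t^_ _⊖_t^_

𝟎 : Polynomial
𝟎 = []

_⊕_t^_ _⊖_t^_ : Polynomial → ℕ → ℕ → Polynomial
p ⊕ c t^ k = (+ c , k) ∷ p
p ⊖ c t^ k = (ℤ.- (+ c) , k) ∷ p

coeff : Polynomial → ℕ → ℤ
coeff []            n = 0ℤ
coeff ((c , k) ∷ p) n = (if n ≡ᵇ k then c else 0ℤ) ℤ.+ coeff p n

⟦_⟧ : Polynomial → PowerSeries
⟦ p ⟧ n = coeff p n ℚ./ 1

A : Polynomial
A = 𝟎 ⊕ 4 t^ 58 ⊖ 5 t^ 56 ⊖ 69 t^ 54 ⊕ 34 t^ 53 ⊕ 36 t^ 52 ⊖ 28 t^ 51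
      ⊕ 334 t^ 50 ⊖ 194 t^ 49 ⊖ 181 t^ 48 ⊕ 196 t^ 47 ⊖ 560 t^ 46 ⊕ 356 t^ 45
      ⊕ 490 t^ 44 ⊖ 396 t^ 43 ⊖ 22 t^ 42 ⊖ 114 t^ 41 ⊖ 240 t^ 40 ⊖ 44 t^ 39
      ⊕ 1056 t^ 38 ⊖ 882 t^ 37 ⊖ 2511 t^ 36 ⊕ 1742 t^ 35 ⊖ 503 t^ 34 ⊕ 2046 t^ 33
      ⊕ 9154 t^ 32 ⊖ 3982 t^ 31 ⊖ 2114 t^ 30 ⊖ 1838 t^ 29 ⊖ 16418 t^ 28 ⊕ 4992 t^ 27
      ⊕ 4087 t^ 26 ⊕ 592 t^ 25 ⊕ 18004 t^ 24 ⊖ 3942 t^ 23 ⊖ 3377 t^ 22 ⊕ 80 t^ 21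
      ⊖ 12769 t^ 20 ⊕ 1978 t^ 19 ⊕ 1476 t^ 18 ⊖ 90 t^ 17 ⊕ 5910 t^ 16 ⊖ 602 t^ 15
      ⊖ 344 t^ 14 ⊕ 20 t^ 13 ⊖ 1742 t^ 12 ⊕ 98 t^ 11 ⊕ 40 t^ 10 ⊖ 2 t^ 9
      ⊕ 306 t^ 8 ⊖ 6 t^ 7 ⊖ 2 t^ 6 ⊖ 28 t^ 4 ⊕ 1 t^ 0

B : Polynomial
B = 𝟎 ⊕ 8 t^ 62 ⊖ 13 t^ 60 ⊖ 12 t^ 59 ⊖ 133 t^ 58 ⊕ 96 t^ 57 ⊕ 103 t^ 56
      ⊕ 138 t^ 55 ⊕ 594 t^ 54 ⊖ 770 t^ 53 ⊖ 406 t^ 52 ⊖ 730 t^ 51 ⊖ 758 t^ 50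
      ⊕ 2786 t^ 49 ⊕ 820 t^ 48 ⊕ 2328 t^ 47 ⊖ 672 t^ 46 ⊖ 6010 t^ 45 ⊕ 118 t^ 44
      ⊖ 5192 t^ 43 ⊕ 1900 t^ 42 ⊕ 7148 t^ 41 ⊖ 7274 t^ 40 ⊕ 9842 t^ 39 ⊕ 2695 t^ 38
      ⊖ 3132 t^ 37 ⊕ 28144 t^ 36 ⊖ 16280 t^ 35 ⊖ 14647 t^ 34 ⊖ 854 t^ 33 ⊖ 59822 t^ 32
      ⊕ 21412 t^ 31 ⊕ 24741 t^ 30 ⊖ 464 t^ 29 ⊕ 79992 t^ 28 ⊖ 20802 t^ 27 ⊖ 22589 t^ 26
      ⊕ 2654 t^ 25 ⊖ 70203 t^ 24 ⊕ 14230 t^ 23 ⊕ 11727 t^ 22 ⊖ 1922 t^ 21 ⊕ 40915 t^ 20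
      ⊖ 6502 t^ 19 ⊖ 3185 t^ 18 ⊕ 498 t^ 17 ⊖ 15672 t^ 16 ⊕ 1834 t^ 15 ⊕ 278 t^ 14
      ⊖ 10 t^ 13 ⊕ 3807 t^ 12 ⊖ 278 t^ 11 ⊕ 59 t^ 10 ⊖ 16 t^ 9 ⊖ 543 t^ 8
      ⊕ 16 t^ 7 ⊖ 15 t^ 6 ⊕ 2 t^ 5 ⊕ 39 t^ 4 ⊕ 1 t^ 2 ⊖ 1 t^ 0

{-# OPTIONS --safe #-}
module Submission where

-- Number the cell (x , y) by p = 8 x + y.  In a tiling the least uncovered cell
-- p is the least cell of exactly one tile, so tilings correspond to paths of a
-- transfer automaton whose state records which of the cells p , … , p + 16 are
-- already covered.  Let M be the action of one column on formal combinations of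
-- states and e the empty frontier.  The coefficients of B(t) Σ aₙ tⁿ are the
-- numbers read off, at the empty frontier, from the vectors
-- w₀ = b₀ e , wₘ₊₁ = M wₘ + bₘ₊₁ e.
-- Only 227 states occur, and the minimal polynomial of e under M turns out to be
-- x⁶ (x⁴ − 1) times the reversal of B; hence wₘ₊₄ = wₘ for m ≥ 68, and finitely many
-- coefficients determine the whole product, which is − A(t).

open import Defs
open import Data.Bool.Base using (Bool; true; false; T; _∧_; if_then_else_)
open import Data.Bool.Properties using (T-∧)
open import Data.Empty using (⊥)
open import Data.Fin.Base using (Fin; zero)
open import Data.Fin.Properties using (+↔⊎)
open import Data.Integer.Base as ℤ using (ℤ; +_; -[1+_]; 0ℤ; 1ℤ)
import Data.Integer.Properties as ℤ
open import Data.Integer.Solver using () renaming (module +-*-Solver to ℤ-Solver)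
open import Data.List.Base using (List; []; _∷_; _++_; map; upTo; applyUpTo)
import Data.List.Properties as List
open import Data.List.Membership.Propositional using (_∈_; find; lose)
open import Data.List.Membership.Propositional.Properties using (∈-map⁻; ∈-∃++)
open import Data.List.Relation.Binary.Disjoint.Propositional using (Disjoint)
open import Data.List.Relation.Binary.Permutation.Propositional
  using (_↭_; ↭-refl; ↭-sym; ↭-trans; ↭-prep)
open import Data.List.Relation.Binary.Permutation.Propositional.Properties
  using (shift; map⁺; All-resp-↭; Any-resp-↭)
open import Data.List.Relation.Unary.All as All using (All; []; _∷_)
open import Data.List.Relation.Unary.AllPairs using (AllPairs; []; _∷_)
open import Data.List.Relation.Unary.Any as Any using (Any; here; there)
open import Data.Maybe.Base as Maybe using (Maybe; just; nothing; maybe′)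
open import Data.Maybe.Properties using (just-injective; maybe′-map)
open import Data.Nat.Base
open import Data.Nat.DivMod
  using (_/_; _%_; m≡m%n+[m/n]*n; [m+n]%n≡m%n; [m+kn]%n≡m%n; m<n⇒m%n≡m; m%n<n; m<n*o⇒m/o<n)
open import Data.Nat.ListAction using (sum)
open import Data.Nat.ListAction.Properties using (sum-↭)
open import Data.Nat.Properties
open import Data.Nat.Solver using () renaming (module +-*-Solver to ℕ-Solver)
open import Data.Product.Base using (_×_; _,_; proj₁; proj₂; ∃; ∃₂)
import Data.Product.Properties as Product
open import Data.Rational.Base as ℚ using (ℚ; 0ℚ; 1ℚ)
import Data.Rational.Properties as ℚ
open import Data.Rational.Solver using () renaming (module +-*-Solver to ℚ-Solver)
import Data.Rational.Unnormalised.Base as ℚᵘ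
import Data.Rational.Unnormalised.Properties as ℚᵘ
open import Data.Sum.Base using (_⊎_; inj₁; inj₂)
open import Data.Sum.Function.Propositional using (_⊎-↔_)
open import Data.Vec.Base using (Vec; []; _∷_; _∷ʳ_; replicate)
open import Function.Base using (_∘_)
open import Function.Bundles using (Equivalence; Inverse; _↔_; mk⇔; mk↔ₛ′)
open import Function.Properties.Inverse using (↔-trans)
open import Relation.Binary.Bundles using (Setoid)
open import Relation.Binary.Definitions using (tri<; tri≈; tri>)
open import Relation.Binary.PropositionalEquality
open import Relation.Binary.PropositionalEquality.WithK using () renaming (≡-irrelevant to uip)
open import Relation.Nullary.Decidable using (Dec; does; yes; no; does-⇔; dec-true; dec-false)
open import Relation.Nullary.Negation using (¬_; contradiction)

-- Counting by frontier

-- The product with B has to be known in all degrees, so a finite check must rest on something that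
-- closes up; finitely many of the counts alone do not. The vectors do. By `eval-step`, `count`,
-- which weighs a frontier by its completions, is adjoint to `step`, which pushes combinations of
-- frontiers forwards; so an identity between combinations holds for the counts at every remaining
-- length. One would hope that wₘ becomes 0 once m exceeds the degree of B. It does not, because of
-- the factor x⁶ (x⁴ - 1), which is invisible to the reading at the empty frontier. Hence the
-- certificate asks for period four together with four zero readings. Pushing forwards also merges
-- equal frontiers, whereas unfolding `count` visits every partial tiling separately. Seventeen bits
-- suffice: the cell of a tile farthest from its least cell lies at most two columns to the right
-- and one row up, 2 · 8 + 1 = 17 places on.

pattern ■ = true
pattern □ = false

-- At position p, the cells p , … , p + 16 that are already covered.
Frontier : Set
Frontier = Vec Bool 17

-- The cells p + 1 , … , p + 17 covered by a tile whose least cell is p.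
footprint : Rotation → Frontier
footprint r₀ = ■ ∷ ■ ∷ □ ∷ □ ∷ □ ∷ □ ∷ □ ∷ ■ ∷ □ ∷ □ ∷ □ ∷ □ ∷ □ ∷ □ ∷ □ ∷ □ ∷ □ ∷ []
footprint r₁ = ■ ∷ □ ∷ □ ∷ □ ∷ □ ∷ □ ∷ □ ∷ □ ∷ ■ ∷ □ ∷ □ ∷ □ ∷ □ ∷ □ ∷ □ ∷ □ ∷ ■ ∷ []
footprint r₂ = □ ∷ □ ∷ □ ∷ □ ∷ □ ∷ □ ∷ □ ∷ ■ ∷ □ ∷ □ ∷ □ ∷ □ ∷ □ ∷ □ ∷ □ ∷ ■ ∷ ■ ∷ []
footprint r₃ = □ ∷ □ ∷ □ ∷ □ ∷ □ ∷ ■ ∷ ■ ∷ ■ ∷ □ ∷ □ ∷ □ ∷ □ ∷ □ ∷ □ ∷ □ ∷ □ ∷ □ ∷ []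

-- lead k is the vertical distance from the offset of a tile to its least cell
-- (only r₃ misses its offset), height k that to its top row.
lead height : Rotation → ℕ
lead r₀ = 0
lead r₁ = 0
lead r₂ = 0
lead r₃ = 2
height r₀ = 2
height r₁ = 1
height r₂ = 1
height r₃ = 2

-- In the linear numbering a tile that leaves the strip vertically would wrap around into a
-- neighbouring column. Here y is the row of the least cell, and the first conjunct makes the
-- truncated subtraction exact.
fits : Rotation → ℕ → Bool
fits k y = (lead k ≤ᵇ y) ∧ (y ∸ lead k + height k <ᵇ 8)

overlay : ∀ {n} → Vec Bool n → Vec Bool n → Maybe (Vec Bool n)
overlay []      []      = just []
overlay (□ ∷ b) (x ∷ m) = Maybe.map (x ∷_) (overlay b m)
overlay (■ ∷ b) (□ ∷ m) = Maybe.map (■ ∷_) (overlay b m)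
overlay (■ ∷ b) (■ ∷ m) = nothing

place : Rotation → ℕ → Frontier → Maybe Frontier
place k p m = if fits k (p % 8) then overlay (footprint k) m else nothing

isEmpty : ∀ {n} → Vec Bool n → ℕ
isEmpty []      = 1
isEmpty (□ ∷ m) = isEmpty m
isEmpty (■ ∷ m) = 0

-- Here l is the number of cells still to visit. Nothing stops a tile from crossing the right edge:
-- its outer cells remain in the last frontier, where `isEmpty` rejects them.
count : ℕ → ℕ → Frontier → ℕ
count-lay : ℕ → ℕ → Frontier → Rotation → ℕ
count zero    p m       = isEmpty m
count (suc l) p (■ ∷ m) = count l (suc p) (m ∷ʳ □)
count (suc l) p (□ ∷ m) = c r₀ + (c r₁ + (c r₂ + c r₃))
  where c = count-lay l p (m ∷ʳ □)
count-lay l p m k = maybe′ (count l (suc p)) 0 (place k p m)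

-- The position enters only through its row p % 8. This is what lets eight steps be iterated as one
-- fixed operator `column`.
count-periodic : ∀ l p m → count l (8 + p) m ≡ count l p m
count-periodic zero    p m       = refl
count-periodic (suc l) p (■ ∷ m) = count-periodic l (suc p) (m ∷ʳ □)
count-periodic (suc l) p (□ ∷ m) = cong₂ _+_ (c r₀) (cong₂ _+_ (c r₁) (cong₂ _+_ (c r₂) (c r₃)))
  where
  8+p%8 : (8 + p) % 8 ≡ p % 8
  8+p%8 = trans (cong (_% 8) (+-comm 8 p)) ([m+n]%n≡m%n p 8)

  maybe-periodic : ∀ x → maybe′ (count l (suc (8 + p))) 0 x ≡ maybe′ (count l (suc p)) 0 x
  maybe-periodic nothing   = refl
  maybe-periodic (just m′) = count-periodic l (suc p) m′

  c : ∀ k → count-lay l (8 + p) (m ∷ʳ □) k ≡ count-lay l p (m ∷ʳ □) k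
  c k = trans (maybe-periodic (place k (8 + p) (m ∷ʳ □)))
    (cong (λ y → maybe′ (count l (suc p)) 0 (if fits k y then overlay (footprint k) (m ∷ʳ □) else nothing)) 8+p%8)

#tilings : ℕ → ℕ
#tilings n = count (n * 8) 0 (replicate 17 □)

-- Tilings and paths of frontiers

χ : Bool → ℕ
χ true  = 1
χ false = 0

δ : ℕ → ℕ → ℕ
δ p q = χ (does (p ≟ q))

δ-refl : ∀ p → δ p p ≡ 1
δ-refl p = cong χ (dec-true (p ≟ p) refl)

δ-≢ : ∀ {p q} → p ≢ q → δ p q ≡ 0
δ-≢ {p} {q} p≢q = cong χ (dec-false (p ≟ q) p≢q)

-- Frontiers, footprints and lists of tiles are all turned into multiplicity functions on cell
-- numbers. Overlaps then show up as values above 1, and removing a cell or a tile is additive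
-- cancellation.
occ : ∀ {n} → ℕ → Vec Bool n → ℕ → ℕ
occ p []      q = 0
occ p (■ ∷ m) q = δ p q + occ (suc p) m q
occ p (□ ∷ m) q = occ (suc p) m q

occ-below : ∀ {n p q} (m : Vec Bool n) → q < p → occ p m q ≡ 0
occ-below []      q<p = refl
occ-below (■ ∷ m) q<p = cong₂ _+_ (δ-≢ (>⇒≢ q<p)) (occ-below m (m<n⇒m<1+n q<p))
occ-below (□ ∷ m) q<p = occ-below m (m<n⇒m<1+n q<p)

occ-head : ∀ {n} p (m : Vec Bool n) → occ p (■ ∷ m) p ≡ 1
occ-head p m = cong₂ _+_ (δ-refl p) (occ-below m (n<1+n p))

occ≤1 : ∀ {n} p (m : Vec Bool n) q → occ p m q ≤ 1
occ≤1 p []      q = z≤n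
occ≤1 p (□ ∷ m) q = occ≤1 (suc p) m q
occ≤1 p (■ ∷ m) q with p ≟ q
... | yes refl = ≤-reflexive (occ-head p m)
... | no  p≢q  = ≤-trans (≤-reflexive (cong (_+ occ (suc p) m q) (δ-≢ p≢q))) (occ≤1 (suc p) m q)

occ-replicate : ∀ n p q → occ p (replicate n □) q ≡ 0
occ-replicate zero    p q = refl
occ-replicate (suc n) p q = occ-replicate n (suc p) q

occ-∷ʳ : ∀ {n} p (m : Vec Bool n) q → occ p (m ∷ʳ □) q ≡ occ p m q
occ-∷ʳ p []      q = refl
occ-∷ʳ p (■ ∷ m) q = cong (_+_ (δ p q)) (occ-∷ʳ (suc p) m q)
occ-∷ʳ p (□ ∷ m) q = occ-∷ʳ (suc p) m q

occ-injective : ∀ {n} p (m m′ : Vec Bool n) → (∀ q → occ p m q ≡ occ p m′ q) → m ≡ m′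
occ-injective p []      []       eq = refl
occ-injective p (■ ∷ m) (■ ∷ m′) eq = cong (■ ∷_) (occ-injective (suc p) m m′ λ q → +-cancelˡ-≡ (δ p q) _ _ (eq q))
occ-injective p (□ ∷ m) (□ ∷ m′) eq = cong (□ ∷_) (occ-injective (suc p) m m′ eq)
occ-injective p (■ ∷ m) (□ ∷ m′) eq =
  contradiction (trans (sym (occ-head p m)) (trans (eq p) (occ-below m′ (n<1+n p)))) λ ()
occ-injective p (□ ∷ m) (■ ∷ m′) eq =
  contradiction (trans (sym (occ-head p m′)) (trans (sym (eq p)) (occ-below m (n<1+n p)))) λ ()

interval : ℕ → ℕ → ℕ → ℕ
interval p l = occ p (replicate l ■)

occ-suc : ∀ {n} p (m : Vec Bool n) q → occ (suc p) m (suc q) ≡ occ p m q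
occ-suc p []      q = refl
occ-suc p (■ ∷ m) q = cong (_+_ (δ p q)) (occ-suc (suc p) m q)
occ-suc p (□ ∷ m) q = occ-suc (suc p) m q

interval-< : ∀ l q → q < l → interval 0 l q ≡ 1
interval-< (suc l) zero    q<l       = cong suc (occ-below (replicate l ■) z<s)
interval-< (suc l) (suc q) (s≤s q<l) = trans (occ-suc 0 (replicate l ■) q) (interval-< l q q<l)

interval-≥ : ∀ l q → l ≤ q → interval 0 l q ≡ 0
interval-≥ zero    q       l≤q       = refl
interval-≥ (suc l) (suc q) (s≤s l≤q) = trans (occ-suc 0 (replicate l ■) q) (interval-≥ l q l≤q)

interval-≢0 : ∀ l q → interval 0 l q ≢ 0 → q < l
interval-≢0 l q ≢0 with q <? l
... | yes q<l = q<l
... | no  q≮l = contradiction (interval-≥ l q (≮⇒≥ q≮l)) ≢0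

overlay-just : ∀ {n} (b m : Vec Bool n) {m′} → overlay b m ≡ just m′ →
               ∀ p q → occ p m′ q ≡ occ p b q + occ p m q
overlay-just []      []      refl p q = refl
overlay-just (□ ∷ b) (x ∷ m) eq   p q with overlay b m in eq′
overlay-just (□ ∷ b) (□ ∷ m) refl p q | just m′ = overlay-just b m eq′ (suc p) q
overlay-just (□ ∷ b) (■ ∷ m) refl p q | just m′ = trans
  (cong (_+_ (δ p q)) (overlay-just b m eq′ (suc p) q))
  (solve 3 (λ x y z → x :+ (y :+ z) := y :+ (x :+ z)) refl (δ p q) (occ (suc p) b q) (occ (suc p) m q))
  where open ℕ-Solver
overlay-just (■ ∷ b) (□ ∷ m) eq   p q with overlay b m in eq′
overlay-just (■ ∷ b) (□ ∷ m) refl p q | just m′ = trans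
  (cong (_+_ (δ p q)) (overlay-just b m eq′ (suc p) q)) (sym (+-assoc (δ p q) _ _))

-- A failed placement exhibits a doubly covered cell; `complete` needs this to exclude failure for
-- the tiles of a genuine tiling.
overlay-nothing : ∀ {n} (b m : Vec Bool n) → overlay b m ≡ nothing →
                  ∀ p → ∃ λ q → 1 ≤ occ p b q × 1 ≤ occ p m q
overlay-nothing []      []      () p
overlay-nothing (□ ∷ b) (x ∷ m) eq p with overlay b m in eq′
overlay-nothing (□ ∷ b) (□ ∷ m) eq p | nothing = overlay-nothing b m eq′ (suc p)
overlay-nothing (□ ∷ b) (■ ∷ m) eq p | nothing = let q , b≥1 , m≥1 = overlay-nothing b m eq′ (suc p) in
  q , b≥1 , m≤n⇒m≤o+n (δ p q) m≥1
overlay-nothing (■ ∷ b) (□ ∷ m) eq p with overlay b m in eq′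
... | nothing = let q , b≥1 , m≥1 = overlay-nothing b m eq′ (suc p) in
  q , m≤n⇒m≤o+n (δ p q) b≥1 , m≥1
overlay-nothing (■ ∷ b) (■ ∷ m) eq p =
  p , ≤-reflexive (sym (occ-head p b)) , ≤-reflexive (sym (occ-head p m))

-- Tiles in the strip and their least cells.

cellAt : ℕ → Cell
cellAt q = (+ (q / 8) , + (q % 8))

_≟ᶜ_ : (c d : Cell) → Dec (c ≡ d)
_≟ᶜ_ = Product.≡-dec ℤ._≟_ ℤ._≟_

hits : Tile → ℕ → ℕ
hits t q = sum (map (λ c → χ (does (c ≟ᶜ cellAt q))) (cells t))

total : List Tile → ℕ → ℕ
total ts q = sum (map (λ t → hits t q) ts)

[y+x*8]%8 : ∀ x {y} → y < 8 → (y + x * 8) % 8 ≡ y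
[y+x*8]%8 x {y} y<8 = trans ([m+kn]%n≡m%n y x 8) (m<n⇒m%n≡m y<8)

[y+x*8]/8 : ∀ x {y} → y < 8 → (y + x * 8) / 8 ≡ x
[y+x*8]/8 x {y} y<8 = *-cancelʳ-≡ ((y + x * 8) / 8) x 8 (+-cancelˡ-≡ y _ _ (begin
  y + (y + x * 8) / 8 * 8                ≡⟨ cong (_+ (y + x * 8) / 8 * 8) ([y+x*8]%8 x y<8) ⟨
  (y + x * 8) % 8 + (y + x * 8) / 8 * 8  ≡⟨ m≡m%n+[m/n]*n (y + x * 8) 8 ⟨
  y + x * 8                              ∎))
  where open ≡-Reasoning

cellAt-index : ∀ x {y} → y < 8 → cellAt (y + x * 8) ≡ (+ x , + y)
cellAt-index x y<8 = cong₂ (λ i j → + i , + j) ([y+x*8]/8 x y<8) ([y+x*8]%8 x y<8)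

cellAt-injective : ∀ p q → cellAt p ≡ cellAt q → p ≡ q
cellAt-injective p q eq = begin
  p                  ≡⟨ m≡m%n+[m/n]*n p 8 ⟩
  p % 8 + p / 8 * 8  ≡⟨ cong₂ (λ i j → i + j * 8) (ℤ.+-injective (cong proj₂ eq)) (ℤ.+-injective (cong proj₁ eq)) ⟩
  q % 8 + q / 8 * 8  ≡⟨ m≡m%n+[m/n]*n q 8 ⟨
  q                  ∎
  where open ≡-Reasoning

anchor : Rotation → ℕ → ℕ → ℕ
anchor k x y = lead k + (y + x * 8)

shifted : ∀ x y dx dy → y + dy < 8 → (+ (x + dx) , + (y + dy)) ≡ cellAt ((dy + dx * 8) + (y + x * 8))
shifted x y dx dy y+dy<8 = trans (sym (cellAt-index (x + dx) y+dy<8)) (cong cellAt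
  (solve 4 (λ x y dx dy → y :+ dy :+ (x :+ dx) :* con 8 := (dy :+ dx :* con 8) :+ (y :+ x :* con 8)) refl x y dx dy))
  where open ℕ-Solver

support : ∀ {n} → ℕ → Vec Bool n → List ℕ
support p []      = []
support p (■ ∷ m) = p ∷ support (suc p) m
support p (□ ∷ m) = support (suc p) m

occ-support : ∀ {n} p (m : Vec Bool n) q → sum (map (λ i → δ i q) (support p m)) ≡ occ p m q
occ-support p []      q = refl
occ-support p (■ ∷ m) q = cong (_+_ (δ p q)) (occ-support (suc p) m q)
occ-support p (□ ∷ m) q = occ-support (suc p) m q

-- `shape` lists the cells of every rotation in increasing order of number, so the two lists agree
-- on the nose and no permutation is involved.
cells-tile : ∀ k x y → y + height k < 8 →
             cells (tile k (+ x , + y)) ≡ map cellAt (support (anchor k x y) (■ ∷ footprint k))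
cells-tile k x y = go k
  where
  infixr 5 _∷≡_
  _∷≡_ : {c d : Cell} {cs ds : List Cell} → c ≡ d → cs ≡ ds → c ∷ cs ≡ d ∷ ds
  _∷≡_ = cong₂ _∷_
  cell : ∀ dx dy {h} → dy ≤ h → y + h < 8 → (+ (x + dx) , + (y + dy)) ≡ cellAt ((dy + dx * 8) + (y + x * 8))
  cell dx dy dy≤h y+h<8 = shifted x y dx dy (≤-<-trans (+-monoʳ-≤ y dy≤h) y+h<8)
  go : ∀ k → y + height k < 8 →
       cells (tile k (+ x , + y)) ≡ map cellAt (support (anchor k x y) (■ ∷ footprint k))
  go r₀ h = cell 0 0 z≤n h ∷≡ cell 0 1 (s≤s z≤n) h ∷≡ cell 0 2 ≤-refl h ∷≡ cell 1 0 z≤n h ∷≡ refl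
  go r₁ h = cell 0 0 z≤n h ∷≡ cell 0 1 ≤-refl h ∷≡ cell 1 1 ≤-refl h ∷≡ cell 2 1 ≤-refl h ∷≡ refl
  go r₂ h = cell 0 0 z≤n h ∷≡ cell 1 0 z≤n h ∷≡ cell 2 0 z≤n h ∷≡ cell 2 1 ≤-refl h ∷≡ refl
  go r₃ h = cell 0 2 ≤-refl h ∷≡ cell 1 0 z≤n h ∷≡ cell 1 1 (s≤s z≤n) h ∷≡ cell 1 2 ≤-refl h ∷≡ refl

tileAt : Rotation → ℕ → Tile
tileAt k p = tile k (+ (p / 8) , + (p % 8 ∸ lead k))

-- Multiplicities are recorded only at numbered cells, so the part of a tile outside the strip would
-- go unnoticed. `Placed` excludes such tiles and names a tile by its least cell.
data Placed : Tile → Set where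
  placed : ∀ k p → T (fits k (p % 8)) → Placed (tileAt k p)

cells-tileAt : ∀ k p → T (fits k (p % 8)) → cells (tileAt k p) ≡ map cellAt (support p (■ ∷ footprint k))
cells-tileAt k p f = trans (cells-tile k (p / 8) (p % 8 ∸ lead k) (<ᵇ⇒< _ 8 (proj₂ lo,hi)))
  (cong (λ i → map cellAt (support i (■ ∷ footprint k))) (begin
    lead k + (p % 8 ∸ lead k + p / 8 * 8)    ≡⟨ +-assoc (lead k) _ _ ⟨
    lead k + (p % 8 ∸ lead k) + p / 8 * 8    ≡⟨ cong (_+ p / 8 * 8) (m+[n∸m]≡n (≤ᵇ⇒≤ (lead k) (p % 8) (proj₁ lo,hi))) ⟩
    p % 8 + p / 8 * 8                        ≡⟨ m≡m%n+[m/n]*n p 8 ⟨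
    p                                        ∎))
  where
  open ≡-Reasoning
  lo,hi : T (lead k ≤ᵇ p % 8) × T (p % 8 ∸ lead k + height k <ᵇ 8)
  lo,hi = Equivalence.to T-∧ f

hits-tileAt : ∀ k p → T (fits k (p % 8)) → ∀ q → hits (tileAt k p) q ≡ occ p (■ ∷ footprint k) q
hits-tileAt k p f q = begin
  hits (tileAt k p) q
    ≡⟨ cong (λ cs → sum (map (λ c → χ (does (c ≟ᶜ cellAt q))) cs)) (cells-tileAt k p f) ⟩
  sum (map (λ c → χ (does (c ≟ᶜ cellAt q))) (map cellAt is))
    ≡⟨ cong sum (List.map-∘ is) ⟨
  sum (map (λ i → χ (does (cellAt i ≟ᶜ cellAt q))) is)
    ≡⟨ cong sum (List.map-cong (λ i → cong χ (does-⇔ (mk⇔ (cellAt-injective i q) (cong cellAt)) (cellAt i ≟ᶜ cellAt q) (i ≟ q))) is) ⟩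
  sum (map (λ i → δ i q) is)
    ≡⟨ occ-support p (■ ∷ footprint k) q ⟩
  occ p (■ ∷ footprint k) q ∎
  where
  open ≡-Reasoning
  is = support p (■ ∷ footprint k)

placed-cell : ∀ {t} → Placed t → ∀ {c} → c ∈ cells t → ∃ λ q → c ≡ cellAt q
placed-cell (placed k p f) {c} c∈ =
  let q , _ , c≡ = ∈-map⁻ cellAt {xs = support p (■ ∷ footprint k)} (subst (c ∈_) (cells-tileAt k p f) c∈) in q , c≡

tile-placed : ∀ k x y → y + height k < 8 → Placed (tile k (+ x , + y))
tile-placed k x y y+h<8 = subst Placed
  (cong₂ (λ i j → tile k (+ i , + j)) p/8≡x (trans (cong (_∸ lead k) p%8≡) (m+n∸m≡n (lead k) y)))
  (placed k p (subst (T ∘ fits k) (sym p%8≡) (Equivalence.from T-∧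
    (≤⇒≤ᵇ (m≤m+n (lead k) y) , <⇒<ᵇ (subst (λ i → i + height k < 8) (sym (m+n∸m≡n (lead k) y)) y+h<8)))))
  where
  p = lead k + y + x * 8
  lead≤height : ∀ k → lead k ≤ height k
  lead≤height r₀ = z≤n
  lead≤height r₁ = z≤n
  lead≤height r₂ = z≤n
  lead≤height r₃ = ≤-refl
  lead+y<8 : lead k + y < 8
  lead+y<8 = ≤-<-trans (≤-trans (≤-reflexive (+-comm (lead k) y)) (+-monoʳ-≤ y (lead≤height k))) y+h<8
  p%8≡ : p % 8 ≡ lead k + y
  p%8≡ = [y+x*8]%8 x lead+y<8
  p/8≡x : p / 8 ≡ x
  p/8≡x = [y+x*8]/8 x lead+y<8

InStrip : Cell → Set
InStrip (x , y) = 0ℤ ℤ.≤ x × (0ℤ ℤ.≤ y × y ℤ.< + 8)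

-- Each bound is read off an extreme cell of the rotation: a leftmost and a lowest cell make the
-- offset natural, a topmost cell gives the height condition.
strip-placed : ∀ t → (∀ c → c ∈ cells t → InStrip c) → Placed t
strip-placed (tile r₀ (-[1+ u ] , v)) s with s _ (here refl)
... | () , _
strip-placed (tile r₀ (+ x , -[1+ v ])) s with s _ (here refl)
... | _ , () , _
strip-placed (tile r₀ (+ x , + y)) s with s _ (there (there (here refl)))
... | _ , _ , ℤ.+<+ h = tile-placed r₀ x y h
strip-placed (tile r₁ (-[1+ u ] , v)) s with s _ (here refl)
... | () , _
strip-placed (tile r₁ (+ x , -[1+ v ])) s with s _ (here refl)
... | _ , () , _
strip-placed (tile r₁ (+ x , + y)) s with s _ (there (here refl))
... | _ , _ , ℤ.+<+ h = tile-placed r₁ x y h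
strip-placed (tile r₂ (-[1+ u ] , v)) s with s _ (here refl)
... | () , _
strip-placed (tile r₂ (+ x , -[1+ v ])) s with s _ (here refl)
... | _ , () , _
strip-placed (tile r₂ (+ x , + y)) s with s _ (there (there (there (here refl))))
... | _ , _ , ℤ.+<+ h = tile-placed r₂ x y h
strip-placed (tile r₃ (-[1+ u ] , v)) s with s _ (here refl)
... | () , _
strip-placed (tile r₃ (+ x , -[1+ v ])) s with s _ (there (here refl))
... | _ , () , _
strip-placed (tile r₃ (+ x , + y)) s with s _ (here refl)
... | _ , _ , ℤ.+<+ h = tile-placed r₃ x y h

-- Disjointness and coverage as multiplicity one.

module _ {X : Set} (f : X → ℕ) where

  sum-positive⁺ : ∀ {xs} → Any (λ x → 1 ≤ f x) xs → 1 ≤ sum (map f xs)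
  sum-positive⁺ {x ∷ xs} (here 1≤fx) = m≤n⇒m≤n+o (sum (map f xs)) 1≤fx
  sum-positive⁺ {x ∷ xs} (there any) = m≤n⇒m≤o+n (f x) (sum-positive⁺ any)

  sum-positive⁻ : ∀ xs → 1 ≤ sum (map f xs) → Any (λ x → 1 ≤ f x) xs
  sum-positive⁻ (x ∷ xs) 1≤ with f x in eq
  ... | zero  = there (sum-positive⁻ xs 1≤)
  ... | suc _ = here (≤-trans (s≤s z≤n) (≤-reflexive (sym eq)))

∈⇒hits : ∀ t q → cellAt q ∈ cells t → 1 ≤ hits t q
∈⇒hits t q q∈ = sum-positive⁺ _ (Any.map (λ {c} q≡c → ≤-reflexive (sym (cong χ (dec-true (c ≟ᶜ cellAt q) (sym q≡c))))) q∈)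

χ-positive : ∀ {A : Set} (a? : Dec A) → 1 ≤ χ (does a?) → A
χ-positive (yes a) _ = a

hits⇒∈ : ∀ t q → 1 ≤ hits t q → cellAt q ∈ cells t
hits⇒∈ t q 1≤ = Any.map (λ {c} 1≤χ → sym (χ-positive (c ≟ᶜ cellAt q) 1≤χ)) (sum-positive⁻ _ (cells t) 1≤)

hits-anchor : ∀ k p → T (fits k (p % 8)) → hits (tileAt k p) p ≡ 1
hits-anchor k p f = trans (hits-tileAt k p f p) (occ-head p (footprint k))

hits≤1 : ∀ {t} → Placed t → ∀ q → hits t q ≤ 1
hits≤1 (placed k p f) q = ≤-trans (≤-reflexive (hits-tileAt k p f q)) (occ≤1 p (■ ∷ footprint k) q)

DisjointTiles : Tile → Tile → Set
DisjointTiles s t = Disjoint (cells s) (cells t)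

-- A common cell would have multiplicity at least two; `Placed` supplies the number q at which to
-- evaluate `total`.
total≤1⇒disjoint : ∀ {ts} → All Placed ts → (∀ q → total ts q ≤ 1) → AllPairs DisjointTiles ts
total≤1⇒disjoint {[]}     []        ≤1 = []
total≤1⇒disjoint {t ∷ ts} (pt ∷ ps) ≤1 =
  All.tabulate (λ s∈ts (c∈t , c∈s) → apart s∈ts c∈t c∈s) ∷
  total≤1⇒disjoint ps λ q → ≤-trans (m≤n+m (total ts q) (hits t q)) (≤1 q)
  where
  apart : ∀ {s c} → s ∈ ts → c ∈ cells t → c ∈ cells s → ⊥
  apart {s} s∈ts c∈t c∈s with placed-cell pt c∈t
  ... | q , refl = contradiction
    (≤-trans (+-mono-≤ (∈⇒hits t q c∈t) (sum-positive⁺ (λ u → hits u q) (lose s∈ts (∈⇒hits s q c∈s)))) (≤1 q))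
    λ { (s≤s ()) }

disjoint⇒total≤1 : ∀ {ts} → All Placed ts → AllPairs DisjointTiles ts → ∀ q → total ts q ≤ 1
disjoint⇒total≤1 []                      []         q = z≤n
disjoint⇒total≤1 {t ∷ ts} (pt ∷ ps) (d ∷ ds) q with hits t q in eq
... | zero  = disjoint⇒total≤1 ps ds q
... | suc h with total ts q in eq′
...   | zero   = ≤-trans (≤-reflexive (trans (+-identityʳ (suc h)) (sym eq))) (hits≤1 pt q)
...   | suc h′ =
  let s , s∈ts , 1≤s = find (sum-positive⁻ (λ u → hits u q) ts (≤-trans (s≤s z≤n) (≤-reflexive (sym eq′)))) in
  contradiction (hits⇒∈ t q (≤-trans (s≤s z≤n) (≤-reflexive (sym eq))) , hits⇒∈ s q 1≤s) (All.lookup d s∈ts)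

-- The successful branches of the recursion of `count`, recorded as data: they are counted by
-- following that recursion and translated into tiles by forgetting the frontiers.
data Path : ℕ → ℕ → Frontier → Set where
  done : ∀ {p m} → m ≡ replicate 17 □ → Path zero p m
  skip : ∀ {l p m} → Path l (suc p) (m ∷ʳ □) → Path (suc l) p (■ ∷ m)
  lay  : ∀ {l p m m′} k → place k p (m ∷ʳ □) ≡ just m′ → Path l (suc p) m′ → Path (suc l) p (□ ∷ m)

toTiles : ∀ {l p m} → Path l p m → List Tile
toTiles (done _)            = []
toTiles (skip π)            = toTiles π
toTiles (lay {p = p} k _ π) = tileAt k p ∷ toTiles π

place-just : ∀ k p {m m′} → place k p m ≡ just m′ → T (fits k (p % 8)) × overlay (footprint k) m ≡ just m′
place-just k p eq with fits k (p % 8)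
... | true = _ , eq

toTiles-placed : ∀ {l p m} (π : Path l p m) → All Placed (toTiles π)
toTiles-placed (done _)             = []
toTiles-placed (skip π)             = toTiles-placed π
toTiles-placed (lay {p = p} k eq π) = placed k p (proj₁ (place-just k p eq)) ∷ toTiles-placed π

-- Disjointness and coverage at once: each cell of the interval has multiplicity one.
exact : ∀ {l p m} (π : Path l p m) q → occ p m q + total (toTiles π) q ≡ interval p l q
exact {p = p} (done refl) q = trans (+-identityʳ _) (occ-replicate 17 p q)
exact {suc l} {p} (skip {m = m} π) q = begin
  δ p q + occ (suc p) m q + total (toTiles π) q           ≡⟨ +-assoc (δ p q) _ _ ⟩
  δ p q + (occ (suc p) m q + total (toTiles π) q)         ≡⟨ cong (λ i → δ p q + (i + total (toTiles π) q)) (occ-∷ʳ (suc p) m q) ⟨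
  δ p q + (occ (suc p) (m ∷ʳ □) q + total (toTiles π) q)  ≡⟨ cong (_+_ (δ p q)) (exact π q) ⟩
  δ p q + interval (suc p) l q                            ∎
  where open ≡-Reasoning
exact {suc l} {p} (lay {m = m} {m′} k eq π) q = begin
  o + (hits (tileAt k p) q + total (toTiles π) q)  ≡⟨ cong (λ i → o + (i + total (toTiles π) q)) (hits-tileAt k p (proj₁ fit) q) ⟩
  o + (δ p q + f + total (toTiles π) q)            ≡⟨ solve 4 (λ o d f t → o :+ (d :+ f :+ t) := d :+ (f :+ o :+ t)) refl o (δ p q) f (total (toTiles π) q) ⟩
  δ p q + (f + o + total (toTiles π) q)            ≡⟨ cong (λ i → δ p q + (f + i + total (toTiles π) q)) (occ-∷ʳ (suc p) m q) ⟨
  δ p q + (f + occ (suc p) (m ∷ʳ □) q + total (toTiles π) q)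
    ≡⟨ cong (λ i → δ p q + (i + total (toTiles π) q)) (overlay-just (footprint k) (m ∷ʳ □) (proj₂ fit) (suc p) q) ⟨
  δ p q + (occ (suc p) m′ q + total (toTiles π) q) ≡⟨ cong (_+_ (δ p q)) (exact π q) ⟩
  δ p q + interval (suc p) l q                     ∎
  where
  open ≡-Reasoning
  open ℕ-Solver
  fit : T (fits k (p % 8)) × overlay (footprint k) (m ∷ʳ □) ≡ just m′
  fit = place-just k p eq
  o f : ℕ
  o = occ (suc p) m q
  f = occ (suc p) (footprint k) q

total-↭ : ∀ {ts us} → ts ↭ us → ∀ q → total ts q ≡ total us q
total-↭ ts↭us q = sum-↭ (map⁺ (λ t → hits t q) ts↭us)

extract : ∀ q ts → 1 ≤ total ts q → ∃₂ λ t us → 1 ≤ hits t q × ts ↭ t ∷ us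
extract q ts 1≤ with find (sum-positive⁻ (λ t → hits t q) ts 1≤)
... | t , t∈ts , 1≤t with ∈-∃++ t∈ts
...   | ys , zs , refl = t , ys ++ zs , 1≤t , shift t ys zs

anchored : ∀ {t p} → Placed t → 1 ≤ hits t p → (∀ q → q < p → hits t q ≡ 0) →
           ∃ λ k → T (fits k (p % 8)) × t ≡ tileAt k p
anchored {p = p} (placed k r f) 1≤ below with <-cmp r p
... | tri< r<p _ _ = contradiction (trans (sym (hits-anchor k r f)) (below r r<p)) λ ()
... | tri≈ _ refl _ = k , f , refl
... | tri> _ _ p<r = contradiction
  (≤-trans 1≤ (≤-reflexive (trans (hits-tileAt k r f p) (occ-below (■ ∷ footprint k) p<r)))) λ ()

place-intro : ∀ k p {m m′} → T (fits k (p % 8)) → overlay (footprint k) m ≡ just m′ → place k p m ≡ just m′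
place-intro k p f eq with fits k (p % 8)
... | true = eq

-- The tiles come in arbitrary order, so the path is rebuilt by looking for the tile over p each
-- time p is uncovered. That tile hits nothing below p, hence is anchored at p, and removing it
-- preserves the multiplicity equation.
complete : ∀ l p m {ts} → All Placed ts → (∀ q → occ p m q + total ts q ≡ interval p l q) →
           ∃ λ (π : Path l p m) → toTiles π ↭ ts
complete zero p m {[]}     _                   eq = done (occ-injective p m (replicate 17 □) λ q →
  trans (m+n≡0⇒m≡0 (occ p m q) (eq q)) (sym (occ-replicate 17 p q))) , ↭-refl
complete zero p m {t ∷ ts} (placed k r f ∷ _) eq = contradiction
  (trans (sym (hits-anchor k r f)) (m+n≡0⇒m≡0 (hits t r) (m+n≡0⇒n≡0 (occ p m r) (eq r)))) λ ()
complete (suc l) p (■ ∷ m) {ts} ps eq =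
  let π , π↭ = complete l (suc p) (m ∷ʳ □) ps λ q → trans (cong (_+ total ts q) (occ-∷ʳ (suc p) m q))
                 (+-cancelˡ-≡ (δ p q) _ _ (trans (sym (+-assoc (δ p q) _ _)) (eq q)))
  in skip π , π↭
complete (suc l) p (□ ∷ m) {ts} ps eq
  -- The remaining bits of the frontier start at `suc p`, so the multiplicity 1 of p must come from
  -- `ts`.
  with extract p ts (≤-reflexive (sym (trans (cong (_+ total ts p) (sym (occ-below m (n<1+n p)))) (trans (eq p) (occ-head p (replicate l ■))))))
... | t , us , 1≤t , ts↭ with All-resp-↭ ts↭ ps
...   | pt ∷ pus with anchored pt 1≤t below
  where
  below : ∀ q → q < p → hits t q ≡ 0
  below q q<p = m+n≡0⇒m≡0 (hits t q) (trans (sym (total-↭ ts↭ q)) (m+n≡0⇒n≡0 (occ (suc p) m q)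
    (trans (eq q) (occ-below (replicate (suc l) ■) q<p))))
...     | k , f , refl = go (overlay (footprint k) (m ∷ʳ □)) refl
  where
  rest : ∀ q → occ (suc p) (footprint k) q + occ (suc p) (m ∷ʳ □) q + total us q ≡ interval (suc p) l q
  rest q = +-cancelˡ-≡ (δ p q) _ _ (begin
    δ p q + (f′ + occ (suc p) (m ∷ʳ □) q + total us q) ≡⟨ cong (λ i → δ p q + (f′ + i + total us q)) (occ-∷ʳ (suc p) m q) ⟩
    δ p q + (f′ + o + total us q)                      ≡⟨ solve 4 (λ o d f t → d :+ (f :+ o :+ t) := o :+ (d :+ f :+ t)) refl o (δ p q) f′ (total us q) ⟩
    o + (δ p q + f′ + total us q)                      ≡⟨ cong (λ i → o + (i + total us q)) (hits-tileAt k p f q) ⟨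
    o + total (tileAt k p ∷ us) q                      ≡⟨ cong (_+_ o) (total-↭ ts↭ q) ⟨
    o + total ts q                                     ≡⟨ eq q ⟩
    δ p q + interval (suc p) l q                       ∎)
    where
    open ≡-Reasoning
    open ℕ-Solver
    o f′ : ℕ
    o = occ (suc p) m q
    f′ = occ (suc p) (footprint k) q
  go : ∀ x → overlay (footprint k) (m ∷ʳ □) ≡ x → ∃ λ (π : Path (suc l) p (□ ∷ m)) → toTiles π ↭ ts
  go (just m′) eq′ =
    let π , π↭ = complete l (suc p) m′ pus λ q →
                   trans (cong (_+ total us q) (overlay-just (footprint k) (m ∷ʳ □) eq′ (suc p) q)) (rest q)
    in lay k (place-intro k p f eq′) π , ↭-trans (↭-prep _ π↭) (↭-sym ts↭)
  -- A clash gives multiplicity at least 2 at some q, while an interval has multiplicity at most 1.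
  go nothing eq′ =
    let q , f≥1 , m≥1 = overlay-nothing (footprint k) (m ∷ʳ □) eq′ (suc p) in
    contradiction (≤-trans (≤-trans (+-mono-≤ f≥1 m≥1) (m≤m+n _ (total us q)))
      (≤-trans (≤-reflexive (rest q)) (occ≤1 (suc p) (replicate l ■) q))) λ { (s≤s ()) }

-- Recovering a path from its set of tiles.

open Setoid tileSetoid using () renaming (_≈_ to _∼_; refl to ∼-refl)

∼⇒⊆ : ∀ s t → s ∼ t → ∀ {c} → c ∈ cells s → c ∈ cells t
∼⇒⊆ s t s∼t = Equivalence.to s∼t

∼⇒⊇ : ∀ s t → s ∼ t → ∀ {c} → c ∈ cells t → c ∈ cells s
∼⇒⊇ s t s∼t = Equivalence.from s∼t

-- By `exact`, the tiles of a path that starts at `suc p` have total multiplicity 0 at p.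
avoids : ∀ {l p m} (π : Path l (suc p) m) t → cellAt p ∈ cells t → ¬ Any (t ∼_) (toTiles π)
avoids {l} {p} {m} π t p∈t any = contradiction
  (≤-trans (sum-positive⁺ (λ s → hits s p) (Any.map (λ {s} → hit s) any))
    (≤-reflexive (m+n≡0⇒n≡0 (occ (suc p) m p) (trans (exact π p) (occ-below (replicate l ■) (n<1+n p)))))) λ ()
  where
  hit : ∀ s → t ∼ s → 1 ≤ hits s p
  hit s t∼s = ∈⇒hits s p (∼⇒⊆ t s t∼s p∈t)

-- Reduces an equality of multiplicities to two implications between membership statements.
bits-≡ : ∀ {m n} → m ≤ 1 → n ≤ 1 → (1 ≤ m → 1 ≤ n) → (1 ≤ n → 1 ≤ m) → m ≡ n
bits-≡ z≤n       z≤n       f g = refl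
bits-≡ z≤n       (s≤s z≤n) f g = contradiction (g ≤-refl) λ ()
bits-≡ (s≤s z≤n) z≤n       f g = contradiction (f ≤-refl) λ ()
bits-≡ (s≤s z≤n) (s≤s z≤n) f g = refl

footprint-injective : ∀ k k′ → footprint k ≡ footprint k′ → k ≡ k′
footprint-injective r₀ r₀ _ = refl
footprint-injective r₁ r₁ _ = refl
footprint-injective r₂ r₂ _ = refl
footprint-injective r₃ r₃ _ = refl
footprint-injective r₀ r₁ ()
footprint-injective r₀ r₂ ()
footprint-injective r₀ r₃ ()
footprint-injective r₁ r₀ ()
footprint-injective r₁ r₂ ()
footprint-injective r₁ r₃ ()
footprint-injective r₂ r₀ ()
footprint-injective r₂ r₁ ()
footprint-injective r₂ r₃ ()
footprint-injective r₃ r₀ ()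
footprint-injective r₃ r₁ ()
footprint-injective r₃ r₂ ()

-- Tiles are compared only as sets of cells, so the rotation has to be read off the set: equal sets
-- have equal multiplicities, these determine the footprint, and the four footprints differ.
tileAt-injective : ∀ {k k′} p → T (fits k (p % 8)) → T (fits k′ (p % 8)) → tileAt k p ∼ tileAt k′ p → k ≡ k′
tileAt-injective {k} {k′} p f f′ t∼t′ = footprint-injective k k′ (occ-injective (suc p) _ _ λ q →
  +-cancelˡ-≡ (δ p q) _ _ (bits-≡ (occ≤1 p (■ ∷ footprint k) q) (occ≤1 p (■ ∷ footprint k′) q)
    (λ 1≤ → transfer k k′ f f′ q (∼⇒⊆ (tileAt k p) (tileAt k′ p) t∼t′) 1≤) (λ 1≤ → transfer k′ k f′ f q (∼⇒⊇ (tileAt k p) (tileAt k′ p) t∼t′) 1≤)))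
  where
  transfer : ∀ k k′ → T (fits k (p % 8)) → T (fits k′ (p % 8)) → ∀ q →
             (cellAt q ∈ cells (tileAt k p) → cellAt q ∈ cells (tileAt k′ p)) →
             1 ≤ occ p (■ ∷ footprint k) q → 1 ≤ occ p (■ ∷ footprint k′) q
  transfer k k′ f f′ q sub 1≤ = ≤-trans
    (∈⇒hits (tileAt k′ p) q (sub (hits⇒∈ (tileAt k p) q (≤-trans 1≤ (≤-reflexive (sym (hits-tileAt k p f q)))))))
    (≤-reflexive (hits-tileAt k′ p f′ q))

-- In either path p lies in the first tile only, so the first tiles must correspond.
toTiles-injective : ∀ {l p m} (π ρ : Path l p m) →
                    (∀ t → Any (t ∼_) (toTiles π) → Any (t ∼_) (toTiles ρ)) → π ≡ ρ
toTiles-injective (done refl) (done refl) sub = refl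
toTiles-injective (skip π)    (skip ρ)    sub = cong skip (toTiles-injective π ρ sub)
toTiles-injective {p = p} (lay k e π) (lay k′ e′ ρ) sub = result
  where
  p∈ : ∀ k {m m′} → place k p m ≡ just m′ → cellAt p ∈ cells (tileAt k p)
  p∈ k e = hits⇒∈ (tileAt k p) p (≤-reflexive (sym (hits-anchor k p (proj₁ (place-just k p e)))))
  head∼ : Any (tileAt k p ∼_) (tileAt k′ p ∷ toTiles ρ) → k ≡ k′
  head∼ (here t∼t′) = tileAt-injective p (proj₁ (place-just k p e)) (proj₁ (place-just k′ p e′)) t∼t′
  head∼ (there any) = contradiction any (avoids ρ (tileAt k p) (p∈ k e))
  tail∼ : ∀ t → Any (t ∼_) (toTiles π) → Any (t ∼_) (tileAt k′ p ∷ toTiles ρ) → Any (t ∼_) (toTiles ρ)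
  tail∼ t any (here t∼t′)  = contradiction any (avoids π t (∼⇒⊇ t (tileAt k′ p) t∼t′ (p∈ k′ e′)))
  tail∼ t any (there any′) = any′
  -- Both rotations and both frontiers are variables here, so that their equalities can be matched.
  -- The recursive call arrives as an argument, made by the caller on the structurally smaller π.
  lay-cong : ∀ {l m m₁ m₂ k k′} (e : place k p (m ∷ʳ □) ≡ just m₁) (e′ : place k′ p (m ∷ʳ □) ≡ just m₂)
             (π : Path l (suc p) m₁) (ρ : Path l (suc p) m₂) → k ≡ k′ →
             (∀ t → Any (t ∼_) (toTiles π) → Any (t ∼_) (toTiles ρ)) →
             (∀ (ρ : Path l (suc p) m₁) → (∀ t → Any (t ∼_) (toTiles π) → Any (t ∼_) (toTiles ρ)) → π ≡ ρ) →
             lay k e π ≡ lay k′ e′ ρ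
  lay-cong e e′ π ρ refl sub rec with just-injective (trans (sym e) e′)
  lay-cong e e′ π ρ refl sub rec | refl = cong₂ (lay _) (uip e e′) (rec ρ sub)
  result : lay k e π ≡ lay k′ e′ ρ
  result = lay-cong e e′ π ρ (head∼ (sub (tileAt k p) (here (λ {x} → ∼-refl {tileAt k p} {x}))))
    (λ t any → tail∼ t any (sub t (there any))) (λ ρ → toTiles-injective π ρ)

-- Numbers of paths.

isEmpty↔ : ∀ {n} (m : Vec Bool n) → Fin (isEmpty m) ↔ m ≡ replicate n □
isEmpty↔ []      = mk↔ₛ′ (λ _ → refl) (λ _ → zero) (λ { refl → refl }) (λ { zero → refl })
isEmpty↔ (■ ∷ m) = mk↔ₛ′ (λ ()) (λ ()) (λ ()) (λ ())
isEmpty↔ (□ ∷ m) = ↔-trans (isEmpty↔ m)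
  (mk↔ₛ′ (λ { refl → refl }) (λ { refl → refl }) (λ { refl → refl }) (λ { refl → refl }))

Lay : ℕ → ℕ → Vec Bool 16 → Rotation → Set
Lay l p m k = ∃ λ m′ → place k p (m ∷ʳ □) ≡ just m′ × Path l (suc p) m′

layings : ∀ {l p m} → (Lay l p m r₀ ⊎ Lay l p m r₁ ⊎ Lay l p m r₂ ⊎ Lay l p m r₃) ↔ Path (suc l) p (□ ∷ m)
layings {l} {p} {m} = mk↔ₛ′ to from
  (λ { (lay r₀ e π) → refl ; (lay r₁ e π) → refl ; (lay r₂ e π) → refl ; (lay r₃ e π) → refl })
  (λ { (inj₁ _) → refl ; (inj₂ (inj₁ _)) → refl ; (inj₂ (inj₂ (inj₁ _))) → refl ; (inj₂ (inj₂ (inj₂ _))) → refl })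
  where
  to : Lay l p m r₀ ⊎ Lay l p m r₁ ⊎ Lay l p m r₂ ⊎ Lay l p m r₃ → Path (suc l) p (□ ∷ m)
  to (inj₁ (_ , e , π))                = lay r₀ e π
  to (inj₂ (inj₁ (_ , e , π)))         = lay r₁ e π
  to (inj₂ (inj₂ (inj₁ (_ , e , π))))  = lay r₂ e π
  to (inj₂ (inj₂ (inj₂ (_ , e , π))))  = lay r₃ e π
  from : Path (suc l) p (□ ∷ m) → Lay l p m r₀ ⊎ Lay l p m r₁ ⊎ Lay l p m r₂ ⊎ Lay l p m r₃
  from (lay r₀ e π) = inj₁ (_ , e , π)
  from (lay r₁ e π) = inj₂ (inj₁ (_ , e , π))
  from (lay r₂ e π) = inj₂ (inj₂ (inj₁ (_ , e , π)))
  from (lay r₃ e π) = inj₂ (inj₂ (inj₂ (_ , e , π)))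

-- Sums in `count` become disjoint unions over the rotation of the next tile, and the value 0 for a
-- failed placement becomes an empty type.
count↔ : ∀ l p m → Fin (count l p m) ↔ Path l p m
count↔ zero    p m       = ↔-trans (isEmpty↔ m) (mk↔ₛ′ done (λ { (done e) → e }) (λ { (done _) → refl }) (λ _ → refl))
count↔ (suc l) p (■ ∷ m) = ↔-trans (count↔ l (suc p) (m ∷ʳ □))
  (mk↔ₛ′ skip (λ { (skip π) → π }) (λ { (skip _) → refl }) (λ _ → refl))
count↔ (suc l) p (□ ∷ m) = ↔-trans (↔-trans +↔⊎ (one r₀ ⊎-↔ ↔-trans +↔⊎ (one r₁ ⊎-↔ ↔-trans +↔⊎ (one r₂ ⊎-↔ one r₃)))) layings
  where
  maybe↔ : ∀ x → Fin (maybe′ (count l (suc p)) 0 x) ↔ (∃ λ m′ → x ≡ just m′ × Path l (suc p) m′)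
  maybe↔ nothing   = mk↔ₛ′ (λ ()) (λ { (_ , () , _) }) (λ { (_ , () , _) }) (λ ())
  maybe↔ (just m′) = ↔-trans (count↔ l (suc p) m′)
    (mk↔ₛ′ (λ π → m′ , refl , π) (λ { (_ , refl , π) → π }) (λ { (_ , refl , _) → refl }) (λ _ → refl))
  one : ∀ k → Fin (count-lay l p (m ∷ʳ □) k) ↔ Lay l p m k
  one k = maybe↔ (place k p (m ∷ʳ □))

-- Tilings of the board.

inBoard⁻ : ∀ n c → InBoard 8 n c → ∃ λ q → q < n * 8 × c ≡ cellAt q
inBoard⁻ n (+ x , + y) ((_ , ℤ.+<+ x<n) , (_ , ℤ.+<+ y<8)) = y + x * 8 ,
  ≤-trans (+-monoˡ-< (x * 8) y<8) (*-monoˡ-≤ 8 x<n) , sym (cellAt-index x y<8)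

inBoard⁺ : ∀ n q → q < n * 8 → InBoard 8 n (cellAt q)
inBoard⁺ n q q<n*8 = (ℤ.+≤+ z≤n , ℤ.+<+ (m<n*o⇒m/o<n q<n*8)) , (ℤ.+≤+ z≤n , ℤ.+<+ (m%n<n q 8))

inBoard-cellAt : ∀ n q → InBoard 8 n (cellAt q) → q < n * 8
inBoard-cellAt n q inb = let r , r<n*8 , eq = inBoard⁻ n (cellAt q) inb in
  subst (_< n * 8) (sym (cellAt-injective q r eq)) r<n*8

toTiling : ∀ n → Path (n * 8) 0 (replicate 17 □) → Tiling 8 n
toTiling n π = record
  { tiles    = toTiles π
  ; disjoint = total≤1⇒disjoint ps λ q → ≤-trans (≤-reflexive (total≡ q)) (occ≤1 0 (replicate (n * 8) ■) q)
  ; covers   = λ c → mk⇔ (covered c) (inside c)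
  }
  where
  ps = toTiles-placed π
  total≡ : ∀ q → total (toTiles π) q ≡ interval 0 (n * 8) q
  total≡ q = trans (cong (_+ total (toTiles π) q) (sym (occ-replicate 17 0 q))) (exact π q)
  covered : ∀ c → InBoard 8 n c → Any (λ t → c ∈ cells t) (toTiles π)
  covered c inb with inBoard⁻ n c inb
  ... | q , q<n*8 , refl = Any.map (λ {t} → hits⇒∈ t q) (sum-positive⁻ (λ t → hits t q) (toTiles π)
    (≤-reflexive (sym (trans (total≡ q) (interval-< (n * 8) q q<n*8)))))
  inside : ∀ c → Any (λ t → c ∈ cells t) (toTiles π) → InBoard 8 n c
  inside c any with find any
  ... | t , t∈ , c∈t with placed-cell (All.lookup ps t∈) c∈t
  ...   | q , refl = inBoard⁺ n q (interval-≢0 (n * 8) q λ ≡0 → contradiction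
    (≤-trans (sum-positive⁺ (λ t → hits t q) (Any.map (λ {t} → ∈⇒hits t q) any)) (≤-reflexive (trans (total≡ q) ≡0))) λ ())

fromTiling : ∀ n (U : Tiling 8 n) → ∃ λ (π : Path (n * 8) 0 (replicate 17 □)) → toTiles π ↭ tiles U
fromTiling n U = complete (n * 8) 0 (replicate 17 □) ps λ q →
  trans (cong (_+ total (tiles U) q) (occ-replicate 17 0 q)) (total≡ q)
  where
  inside : ∀ {t} → t ∈ tiles U → ∀ c → c ∈ cells t → InBoard 8 n c
  inside t∈ c c∈t = Equivalence.from (Tiling.covers U c) (lose t∈ c∈t)
  ps : All Placed (tiles U)
  ps = All.tabulate λ {t} t∈ → strip-placed t λ c c∈t → let (0≤x , _) , 0≤y<8 = inside t∈ c c∈t in 0≤x , 0≤y<8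
  total≡ : ∀ q → total (tiles U) q ≡ interval 0 (n * 8) q
  total≡ q = bits-≡ (disjoint⇒total≤1 ps (Tiling.disjoint U) q) (occ≤1 0 (replicate (n * 8) ■) q)
    (λ 1≤ → let t , t∈ , 1≤t = find (sum-positive⁻ (λ t → hits t q) (tiles U) 1≤) in
      ≤-reflexive (sym (interval-< (n * 8) q (inBoard-cellAt n q (inside t∈ _ (hits⇒∈ t q 1≤t))))))
    (λ 1≤ → sum-positive⁺ (λ t → hits t q) (Any.map (λ {t} → ∈⇒hits t q) (Equivalence.to (Tiling.covers U (cellAt q))
      (inBoard⁺ n q (interval-≢0 (n * 8) q λ ≡0 → contradiction (≤-trans 1≤ (≤-reflexive ≡0)) λ ())))))

cardinality : ∀ n → HasCardinality (tilingSetoid 8 n) (#tilings n)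
cardinality n = record
  { to        = λ i → toTiling n (to i)
  ; cong      = λ { refl → Setoid.refl (tilingSetoid 8 n) {toTiling n (to _)} }
  ; bijective =
      (λ {i} {j} i≈j → trans (sym (strictlyInverseʳ i)) (trans (cong from (toTiles-injective (to i) (to j) (λ t → proj₁ i≈j {t}))) (strictlyInverseʳ j))) ,
      -- The path reproduces the tiles of U up to permutation, which suffices because tilings are
      -- compared as sets of tiles.
      λ U → let π , π↭ = fromTiling n U in from π , λ { refl →
        subst (λ ρ → Setoid._≈_ (tilingSetoid 8 n) (toTiling n ρ) U) (sym (strictlyInverseˡ π))
          ((λ {t} → Any-resp-↭ π↭) , (λ {t} → Any-resp-↭ (↭-sym π↭))) }
  }
  where open Inverse (count↔ (n * 8) 0 (replicate 17 □))

-- Formal combinations of frontiers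

-- ℤ-linear combinations of bit vectors, as binary tries.  Empty subtries are
-- pruned by leaf′ and node′, so equal combinations are structurally equal.
data Comb : ℕ → Set where
  null : ∀ {n} → Comb n
  leaf : ℤ → Comb 0
  node : ∀ {n} → Comb n → Comb n → Comb (suc n)

leaf′ : ℤ → Comb 0
leaf′ (+ 0) = null
leaf′ z     = leaf z

node′ : ∀ {n} → Comb n → Comb n → Comb (suc n)
node′ null null = null
node′ l    r    = node l r

infixl 6 _⊞_
_⊞_ : ∀ {n} → Comb n → Comb n → Comb n
null     ⊞ v          = v
leaf a   ⊞ null       = leaf a
leaf a   ⊞ leaf b     = leaf′ (a ℤ.+ b)
node l r ⊞ null       = node l r
node l r ⊞ node l′ r′ = node′ (l ⊞ l′) (r ⊞ r′)

extendᶜ : ∀ {n} → Comb n → Comb (suc n)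
extendᶜ null       = null
extendᶜ (leaf a)   = node (leaf a) null
extendᶜ (node l r) = node (extendᶜ l) (extendᶜ r)

-- One pass lays the tile on all frontiers at once: at a ■ of the tile the occupied branch clashes
-- and is dropped, and the free branch becomes the occupied one.
overlayᶜ : ∀ {n} → Vec Bool n → Comb n → Comb n
overlayᶜ _       null       = null
overlayᶜ []      (leaf a)   = leaf a
overlayᶜ (□ ∷ b) (node l r) = node′ (overlayᶜ b l) (overlayᶜ b r)
overlayᶜ (■ ∷ b) (node l r) = node′ null (overlayᶜ b l)

placeᶜ : Rotation → ℕ → Comb 17 → Comb 17
placeᶜ k p u = if fits k (p % 8) then overlayᶜ (footprint k) u else null

layᶜ : ℕ → Comb 17 → Comb 17
layᶜ p u = placeᶜ r₀ p u ⊞ (placeᶜ r₁ p u ⊞ (placeᶜ r₂ p u ⊞ placeᶜ r₃ p u))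

-- The root of the trie branches on the cell p itself: the free branch l must receive a tile, the
-- covered branch r is merely shifted.
step : ℕ → Comb 17 → Comb 17
step p null       = null
step p (node l r) = extendᶜ r ⊞ layᶜ p (extendᶜ l)

column : Comb 17 → Comb 17
column u = step 7 (step 6 (step 5 (step 4 (step 3 (step 2 (step 1 (step 0 u)))))))

blank : ∀ n → ℤ → Comb n
blank zero    z = leaf′ z
blank (suc n) z = node′ (blank n z) null

-- The coefficient of the empty frontier, that is, the reading of the overview.
constant : ∀ {n} → Comb n → ℤ
constant null       = 0ℤ
constant (leaf z)   = z
constant (node l r) = constant l

-- The bilinear pairing of functions on bit vectors with formal combinations of them.
eval : ∀ {n} → (Vec Bool n → ℤ) → Comb n → ℤ
eval f null       = 0ℤ
eval f (leaf z)   = z ℤ.* f []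
eval f (node l r) = eval (f ∘ (□ ∷_)) l ℤ.+ eval (f ∘ (■ ∷_)) r

eval-cong : ∀ {n} {f g : Vec Bool n → ℤ} → f ≗ g → eval f ≗ eval g
eval-cong f≗g null       = refl
eval-cong f≗g (leaf z)   = cong (z ℤ.*_) (f≗g [])
eval-cong f≗g (node l r) = cong₂ ℤ._+_ (eval-cong (f≗g ∘ (□ ∷_)) l) (eval-cong (f≗g ∘ (■ ∷_)) r)

eval-zero : ∀ {n} (u : Comb n) → eval (λ _ → 0ℤ) u ≡ 0ℤ
eval-zero null       = refl
eval-zero (leaf z)   = ℤ.*-zeroʳ z
eval-zero (node l r) = cong₂ ℤ._+_ (eval-zero l) (eval-zero r)

interchange : ∀ a b c d → (a ℤ.+ b) ℤ.+ (c ℤ.+ d) ≡ (a ℤ.+ c) ℤ.+ (b ℤ.+ d)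
interchange = solve 4 (λ a b c d → (a :+ b) :+ (c :+ d) := (a :+ c) :+ (b :+ d)) refl
  where open ℤ-Solver

eval-+ : ∀ {n} (f g : Vec Bool n → ℤ) u → eval (λ m → f m ℤ.+ g m) u ≡ eval f u ℤ.+ eval g u
eval-+ f g null       = refl
eval-+ f g (leaf z)   = ℤ.*-distribˡ-+ z (f []) (g [])
eval-+ f g (node l r) = trans
  (cong₂ ℤ._+_ (eval-+ (f ∘ (□ ∷_)) (g ∘ (□ ∷_)) l) (eval-+ (f ∘ (■ ∷_)) (g ∘ (■ ∷_)) r))
  (interchange (eval (f ∘ (□ ∷_)) l) _ _ _)

eval-leaf′ : ∀ f z → eval f (leaf′ z) ≡ z ℤ.* f []
eval-leaf′ f (+ zero)  = refl
eval-leaf′ f (+ suc n) = refl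
eval-leaf′ f -[1+ n ]  = refl

eval-node′ : ∀ {n} (f : Vec Bool (suc n) → ℤ) l r →
             eval f (node′ l r) ≡ eval (f ∘ (□ ∷_)) l ℤ.+ eval (f ∘ (■ ∷_)) r
eval-node′ f null       null       = refl
eval-node′ f null       (leaf _)   = refl
eval-node′ f null       (node _ _) = refl
eval-node′ f (leaf _)   _          = refl
eval-node′ f (node _ _) _          = refl

eval-⊞ : ∀ {n} (f : Vec Bool n → ℤ) u v → eval f (u ⊞ v) ≡ eval f u ℤ.+ eval f v
eval-⊞ f null       v            = sym (ℤ.+-identityˡ (eval f v))
eval-⊞ f (leaf a)   null         = sym (ℤ.+-identityʳ _)
eval-⊞ f (leaf a)   (leaf b)     = trans (eval-leaf′ f (a ℤ.+ b)) (ℤ.*-distribʳ-+ (f []) a b)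
eval-⊞ f (node l r) null         = sym (ℤ.+-identityʳ _)
eval-⊞ f (node l r) (node l′ r′) = begin
  eval f (node′ (l ⊞ l′) (r ⊞ r′))                          ≡⟨ eval-node′ f (l ⊞ l′) (r ⊞ r′) ⟩
  eval f□ (l ⊞ l′) ℤ.+ eval f■ (r ⊞ r′)                     ≡⟨ cong₂ ℤ._+_ (eval-⊞ f□ l l′) (eval-⊞ f■ r r′) ⟩
  (eval f□ l ℤ.+ eval f□ l′) ℤ.+ (eval f■ r ℤ.+ eval f■ r′) ≡⟨ interchange (eval f□ l) _ _ _ ⟩
  (eval f□ l ℤ.+ eval f■ r) ℤ.+ (eval f□ l′ ℤ.+ eval f■ r′) ∎
  where
  open ≡-Reasoning
  f□ = f ∘ (□ ∷_)
  f■ = f ∘ (■ ∷_)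

eval-extend : ∀ {n} (f : Vec Bool (suc n) → ℤ) u → eval f (extendᶜ u) ≡ eval (λ m → f (m ∷ʳ □)) u
eval-extend f null       = refl
eval-extend f (leaf a)   = ℤ.+-identityʳ _
eval-extend f (node l r) = cong₂ ℤ._+_ (eval-extend (f ∘ (□ ∷_)) l) (eval-extend (f ∘ (■ ∷_)) r)

eval-overlay : ∀ {n} (f : Vec Bool n → ℤ) b u → eval f (overlayᶜ b u) ≡ eval (maybe′ f 0ℤ ∘ overlay b) u
eval-overlay f b       null       = refl
eval-overlay f []      (leaf a)   = refl
eval-overlay f (□ ∷ b) (node l r) = trans (eval-node′ f (overlayᶜ b l) (overlayᶜ b r)) (cong₂ ℤ._+_
  (trans (eval-overlay (f ∘ (□ ∷_)) b l) (eval-cong (λ m → sym (maybe′-map f 0ℤ (□ ∷_) (overlay b m))) l))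
  (trans (eval-overlay (f ∘ (■ ∷_)) b r) (eval-cong (λ m → sym (maybe′-map f 0ℤ (■ ∷_) (overlay b m))) r)))
eval-overlay f (■ ∷ b) (node l r) = begin
  eval f (node′ null (overlayᶜ b l))
    ≡⟨ eval-node′ f null (overlayᶜ b l) ⟩
  0ℤ ℤ.+ eval (f ∘ (■ ∷_)) (overlayᶜ b l)
    ≡⟨ ℤ.+-comm 0ℤ (eval (f ∘ (■ ∷_)) (overlayᶜ b l)) ⟩
  eval (f ∘ (■ ∷_)) (overlayᶜ b l) ℤ.+ 0ℤ
    ≡⟨ cong₂ ℤ._+_ {u = 0ℤ} (trans (eval-overlay (f ∘ (■ ∷_)) b l)
         (eval-cong (λ m → sym (maybe′-map f 0ℤ (■ ∷_) (overlay b m))) l)) (sym (eval-zero r)) ⟩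
  eval (maybe′ f 0ℤ ∘ overlay (■ ∷ b)) (node l r) ∎
  where open ≡-Reasoning

eval-place : ∀ f k p u → eval f (placeᶜ k p u) ≡ eval (maybe′ f 0ℤ ∘ place k p) u
eval-place f k p u with fits k (p % 8)
... | true  = eval-overlay f (footprint k) u
... | false = sym (eval-zero u)

⟪_,_⟫ : ℕ → ℕ → Frontier → ℤ
⟪ l , p ⟫ m = + count l p m

eval-lay : ∀ l p u → eval ⟪ l , suc p ⟫ (layᶜ p u) ≡
           eval (λ m → let c = count-lay l p m in + (c r₀ + (c r₁ + (c r₂ + c r₃)))) u
eval-lay l p u = begin
  eval f (layᶜ p u)
    ≡⟨ eval-⊞ f (P r₀) (P r₁ ⊞ (P r₂ ⊞ P r₃)) ⟩
  eval f (P r₀) ℤ.+ eval f (P r₁ ⊞ (P r₂ ⊞ P r₃))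
    ≡⟨ cong (ℤ._+_ (eval f (P r₀))) (eval-⊞ f (P r₁) (P r₂ ⊞ P r₃)) ⟩
  eval f (P r₀) ℤ.+ (eval f (P r₁) ℤ.+ eval f (P r₂ ⊞ P r₃))
    ≡⟨ cong (λ x → eval f (P r₀) ℤ.+ (eval f (P r₁) ℤ.+ x)) (eval-⊞ f (P r₂) (P r₃)) ⟩
  eval f (P r₀) ℤ.+ (eval f (P r₁) ℤ.+ (eval f (P r₂) ℤ.+ eval f (P r₃)))
    ≡⟨ cong₂ ℤ._+_ (e r₀) (cong₂ ℤ._+_ (e r₁) (cong₂ ℤ._+_ (e r₂) (e r₃))) ⟩
  eval (c r₀) u ℤ.+ (eval (c r₁) u ℤ.+ (eval (c r₂) u ℤ.+ eval (c r₃) u))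
    ≡⟨ cong (λ x → eval (c r₀) u ℤ.+ (eval (c r₁) u ℤ.+ x)) (eval-+ (c r₂) (c r₃) u) ⟨
  eval (c r₀) u ℤ.+ (eval (c r₁) u ℤ.+ eval (λ m → c r₂ m ℤ.+ c r₃ m) u)
    ≡⟨ cong (ℤ._+_ (eval (c r₀) u)) (eval-+ (c r₁) (λ m → c r₂ m ℤ.+ c r₃ m) u) ⟨
  eval (c r₀) u ℤ.+ eval (λ m → c r₁ m ℤ.+ (c r₂ m ℤ.+ c r₃ m)) u
    ≡⟨ eval-+ (c r₀) (λ m → c r₁ m ℤ.+ (c r₂ m ℤ.+ c r₃ m)) u ⟨
  eval (λ m → c r₀ m ℤ.+ (c r₁ m ℤ.+ (c r₂ m ℤ.+ c r₃ m))) u ∎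
  where
  open ≡-Reasoning
  f = ⟪ l , suc p ⟫
  P : Rotation → Comb 17
  P k = placeᶜ k p u
  c : Rotation → Frontier → ℤ
  c k m = + count-lay l p m k
  pos-maybe : ∀ x → maybe′ f 0ℤ x ≡ + maybe′ (count l (suc p)) 0 x
  pos-maybe nothing  = refl
  pos-maybe (just m) = refl
  e : ∀ k → eval f (P k) ≡ eval (c k) u
  e k = trans (eval-place f k p u) (eval-cong (λ m → pos-maybe (place k p m)) u)

-- The adjunction: unfolding `count` once on the weights is the same as pushing the combination one
-- cell forwards.
eval-step : ∀ l p u → eval ⟪ suc l , p ⟫ u ≡ eval ⟪ l , suc p ⟫ (step p u)
eval-step l p null       = refl
eval-step l p (node u v) = sym (begin
  eval f (extendᶜ v ⊞ layᶜ p (extendᶜ u))             ≡⟨ eval-⊞ f (extendᶜ v) (layᶜ p (extendᶜ u)) ⟩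
  eval f (extendᶜ v) ℤ.+ eval f (layᶜ p (extendᶜ u))  ≡⟨ ℤ.+-comm (eval f (extendᶜ v)) _ ⟩
  eval f (layᶜ p (extendᶜ u)) ℤ.+ eval f (extendᶜ v)
    ≡⟨ cong₂ ℤ._+_ (trans (eval-lay l p (extendᶜ u)) (eval-extend _ u)) (eval-extend f v) ⟩
  eval ⟪ suc l , p ⟫ (node u v)                       ∎)
  where
  open ≡-Reasoning
  f = ⟪ l , suc p ⟫

eval-column : ∀ l u → eval ⟪ 8 + l , 0 ⟫ u ≡ eval ⟪ l , 0 ⟫ (column u)
eval-column l u = begin
  eval ⟪ 8 + l , 0 ⟫ u                      ≡⟨ eval-step (7 + l) 0 u ⟩
  eval ⟪ 7 + l , 1 ⟫ u₁                     ≡⟨ eval-step (6 + l) 1 u₁ ⟩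
  eval ⟪ 6 + l , 2 ⟫ u₂                     ≡⟨ eval-step (5 + l) 2 u₂ ⟩
  eval ⟪ 5 + l , 3 ⟫ u₃                     ≡⟨ eval-step (4 + l) 3 u₃ ⟩
  eval ⟪ 4 + l , 4 ⟫ u₄                     ≡⟨ eval-step (3 + l) 4 u₄ ⟩
  eval ⟪ 3 + l , 5 ⟫ u₅                     ≡⟨ eval-step (2 + l) 5 u₅ ⟩
  eval ⟪ 2 + l , 6 ⟫ u₆                     ≡⟨ eval-step (1 + l) 6 u₆ ⟩
  eval ⟪ 1 + l , 7 ⟫ u₇                     ≡⟨ eval-step l 7 u₇ ⟩
  eval ⟪ l , 8 ⟫ (column u)                 ≡⟨ eval-cong (λ m → cong +_ (count-periodic l 0 m)) (column u) ⟩
  eval ⟪ l , 0 ⟫ (column u)                 ∎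
  where
  open ≡-Reasoning
  u₁ = step 0 u
  u₂ = step 1 u₁
  u₃ = step 2 u₂
  u₄ = step 3 u₃
  u₅ = step 4 u₄
  u₆ = step 5 u₅
  u₇ = step 6 u₆

eval-blank : ∀ n (f : Vec Bool n → ℤ) z → eval f (blank n z) ≡ z ℤ.* f (replicate n □)
eval-blank zero    f z = eval-leaf′ f z
eval-blank (suc n) f z = begin
  eval f (node′ (blank n z) null)      ≡⟨ eval-node′ f (blank n z) null ⟩
  eval (f ∘ (□ ∷_)) (blank n z) ℤ.+ 0ℤ ≡⟨ ℤ.+-identityʳ _ ⟩
  eval (f ∘ (□ ∷_)) (blank n z)        ≡⟨ eval-blank n (f ∘ (□ ∷_)) z ⟩
  z ℤ.* f (replicate (suc n) □)        ∎
  where open ≡-Reasoning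

eval-isEmpty : ∀ {n} (u : Comb n) → eval (+_ ∘ isEmpty) u ≡ constant u
eval-isEmpty null       = refl
eval-isEmpty (leaf z)   = ℤ.*-identityʳ z
eval-isEmpty (node l r) = trans (cong₂ ℤ._+_ (eval-isEmpty l) (eval-zero r)) (ℤ.+-identityʳ _)

-- Boolean, so that the certificate is one closed computation of a truth value and builds no
-- equality proofs while it runs.
_==_ : ∀ {n} → Comb n → Comb n → Bool
null     == null       = true
null     == leaf _     = false
null     == node _ _   = false
leaf a   == null       = false
leaf a   == leaf b     = does (a ℤ.≟ b)
node l r == null       = false
node l r == node l′ r′ = (l == l′) ∧ (r == r′)

∧-true : ∀ {a b} → a ∧ b ≡ true → a ≡ true × b ≡ true
∧-true {true} {true} refl = refl , refl

≟-sound : ∀ {a b} → does (a ℤ.≟ b) ≡ true → a ≡ b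
≟-sound {a} {b} eq with a ℤ.≟ b
... | yes a≡b = a≡b

==-sound : ∀ {n} (u v : Comb n) → (u == v) ≡ true → u ≡ v
==-sound null       null         eq = refl
==-sound (leaf a)   (leaf b)     eq = cong leaf (≟-sound eq)
==-sound (node l r) (node l′ r′) eq = let l≡ , r≡ = ∧-true eq in cong₂ node (==-sound l l′ l≡) (==-sound r r′ r≡)

-- Power series

ι : ℤ → ℚ
ι z = z ℚ./ 1

-- Division by 1 in ℚ still normalises by a gcd, which is stuck on a variable; the detour through
-- unnormalised fractions avoids it.
toℚᵘ-ι : ∀ z → ℚ.toℚᵘ (ι z) ℚᵘ.≃ ℚᵘ.mkℚᵘ z 0
toℚᵘ-ι z = ℚ.toℚᵘ-fromℚᵘ (ℚᵘ.mkℚᵘ z 0)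

ι-+ : ∀ a b → ι (a ℤ.+ b) ≡ ι a ℚ.+ ι b
ι-+ a b = ℚ.toℚᵘ-injective (begin
  ℚ.toℚᵘ (ι (a ℤ.+ b))            ≈⟨ toℚᵘ-ι (a ℤ.+ b) ⟩
  ℚᵘ.mkℚᵘ (a ℤ.+ b) 0             ≈⟨ ℚᵘ.*≡* (cong (ℤ._* (+ 1)) (cong₂ ℤ._+_ (ℤ.*-identityʳ a) (ℤ.*-identityʳ b))) ⟨
  ℚᵘ.mkℚᵘ a 0 ℚᵘ.+ ℚᵘ.mkℚᵘ b 0    ≈⟨ ℚᵘ.+-cong (toℚᵘ-ι a) (toℚᵘ-ι b) ⟨
  ℚ.toℚᵘ (ι a) ℚᵘ.+ ℚ.toℚᵘ (ι b)  ≈⟨ ℚ.toℚᵘ-homo-+ (ι a) (ι b) ⟨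
  ℚ.toℚᵘ (ι a ℚ.+ ι b)            ∎)
  where open ℚᵘ.≃-Reasoning

ι-* : ∀ a b → ι (a ℤ.* b) ≡ ι a ℚ.* ι b
ι-* a b = ℚ.toℚᵘ-injective (begin
  ℚ.toℚᵘ (ι (a ℤ.* b))            ≈⟨ toℚᵘ-ι (a ℤ.* b) ⟩
  ℚᵘ.mkℚᵘ a 0 ℚᵘ.* ℚᵘ.mkℚᵘ b 0    ≈⟨ ℚᵘ.*-cong (toℚᵘ-ι a) (toℚᵘ-ι b) ⟨
  ℚ.toℚᵘ (ι a) ℚᵘ.* ℚ.toℚᵘ (ι b)  ≈⟨ ℚ.toℚᵘ-homo-* (ι a) (ι b) ⟨
  ℚ.toℚᵘ (ι a ℚ.* ι b)            ∎)
  where open ℚᵘ.≃-Reasoning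

ι-neg : ∀ a → ι (ℤ.- a) ≡ ℚ.- ι a
ι-neg (+ zero)  = refl
ι-neg (+ suc n) = refl
ι-neg -[1+ n ]  = solve 1 (λ x → x := :- (:- x)) refl (ι (+ suc n))
  where open ℚ-Solver

⊛-congʳ : ∀ F {G H} n → (∀ m → m ≤ n → G m ≡ H m) → (F ⊛ G) n ≡ (F ⊛ H) n
⊛-congʳ F zero    G≗H = cong (λ x → F 0 ℚ.* x ℚ.+ 0ℚ) (G≗H 0 z≤n)
⊛-congʳ F (suc n) G≗H = cong₂ (λ x y → F 0 ℚ.* x ℚ.+ y) (G≗H (suc n) ≤-refl)
  (⊛-congʳ (F ∘ suc) n λ m m≤n → G≗H m (m≤n⇒m≤1+n m≤n))

-- By definition the sum unfolds at the constant term of F; this is the mirror rule at that of G.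
-- The two rules together give commutativity.
⊛-unfoldʳ : ∀ F G n → (F ⊛ G) (suc n) ≡ F (suc n) ℚ.* G 0 ℚ.+ (F ⊛ (G ∘ suc)) n
⊛-unfoldʳ F G zero    = solve 4 (λ a b c d → a :* b :+ (c :* d :+ con 0ℚ) := c :* d :+ (a :* b :+ con 0ℚ))
  refl (F 0) (G 1) (F 1) (G 0)
  where open ℚ-Solver
⊛-unfoldʳ F G (suc n) = begin
  F 0 ℚ.* G (suc (suc n)) ℚ.+ ((F ∘ suc) ⊛ G) (suc n)
    ≡⟨ cong (λ x → F 0 ℚ.* G (suc (suc n)) ℚ.+ x) (⊛-unfoldʳ (F ∘ suc) G n) ⟩
  F 0 ℚ.* G (suc (suc n)) ℚ.+ (F (suc (suc n)) ℚ.* G 0 ℚ.+ ((F ∘ suc) ⊛ (G ∘ suc)) n)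
    ≡⟨ solve 3 (λ a b c → a :+ (b :+ c) := b :+ (a :+ c)) refl
         (F 0 ℚ.* G (suc (suc n))) (F (suc (suc n)) ℚ.* G 0) (((F ∘ suc) ⊛ (G ∘ suc)) n) ⟩
  F (suc (suc n)) ℚ.* G 0 ℚ.+ (F 0 ℚ.* G (suc (suc n)) ℚ.+ ((F ∘ suc) ⊛ (G ∘ suc)) n) ∎
  where
  open ≡-Reasoning
  open ℚ-Solver

⊛-comm : ∀ F G n → (F ⊛ G) n ≡ (G ⊛ F) n
⊛-comm F G zero    = cong (ℚ._+ 0ℚ) (ℚ.*-comm (F 0) (G 0))
⊛-comm F G (suc n) = begin
  F 0 ℚ.* G (suc n) ℚ.+ ((F ∘ suc) ⊛ G) n  ≡⟨ cong₂ ℚ._+_ (ℚ.*-comm (F 0) (G (suc n))) (⊛-comm (F ∘ suc) G n) ⟩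
  G (suc n) ℚ.* F 0 ℚ.+ (G ⊛ (F ∘ suc)) n  ≡⟨ ⊛-unfoldʳ G F n ⟨
  (G ⊛ F) (suc n)                          ∎
  where open ≡-Reasoning

-- The combination c F + G has the shape of a product unfolded once, as it arises in `⊛-assoc`.
⊛-linearˡ : ∀ c F G H n → ((λ m → c ℚ.* F m ℚ.+ G m) ⊛ H) n ≡ c ℚ.* (F ⊛ H) n ℚ.+ (G ⊛ H) n
⊛-linearˡ c F G H zero    = solve 4 (λ c f g h → (c :* f :+ g) :* h :+ con 0ℚ :=
    c :* (f :* h :+ con 0ℚ) :+ (g :* h :+ con 0ℚ)) refl c (F 0) (G 0) (H 0)
  where open ℚ-Solver
⊛-linearˡ c F G H (suc n) = begin
  (c ℚ.* F 0 ℚ.+ G 0) ℚ.* H (suc n) ℚ.+ ((λ m → c ℚ.* F (suc m) ℚ.+ G (suc m)) ⊛ H) n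
    ≡⟨ cong (ℚ._+_ ((c ℚ.* F 0 ℚ.+ G 0) ℚ.* H (suc n))) (⊛-linearˡ c (F ∘ suc) (G ∘ suc) H n) ⟩
  (c ℚ.* F 0 ℚ.+ G 0) ℚ.* H (suc n) ℚ.+ (c ℚ.* ((F ∘ suc) ⊛ H) n ℚ.+ ((G ∘ suc) ⊛ H) n)
    ≡⟨ solve 6 (λ c f g h x y → (c :* f :+ g) :* h :+ (c :* x :+ y) :=
         c :* (f :* h :+ x) :+ (g :* h :+ y)) refl
         c (F 0) (G 0) (H (suc n)) (((F ∘ suc) ⊛ H) n) (((G ∘ suc) ⊛ H) n) ⟩
  c ℚ.* (F ⊛ H) (suc n) ℚ.+ (G ⊛ H) (suc n) ∎
  where
  open ≡-Reasoning
  open ℚ-Solver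

⊛-assoc : ∀ F G H n → ((F ⊛ G) ⊛ H) n ≡ (F ⊛ (G ⊛ H)) n
⊛-assoc F G H zero    = solve 3 (λ f g h → (f :* g :+ con 0ℚ) :* h :+ con 0ℚ := f :* (g :* h :+ con 0ℚ) :+ con 0ℚ)
  refl (F 0) (G 0) (H 0)
  where open ℚ-Solver
⊛-assoc F G H (suc n) = begin
  (F 0 ℚ.* G 0 ℚ.+ 0ℚ) ℚ.* H (suc n) ℚ.+ ((λ m → F 0 ℚ.* G (suc m) ℚ.+ ((F ∘ suc) ⊛ G) m) ⊛ H) n
    ≡⟨ cong (ℚ._+_ ((F 0 ℚ.* G 0 ℚ.+ 0ℚ) ℚ.* H (suc n))) (⊛-linearˡ (F 0) (G ∘ suc) ((F ∘ suc) ⊛ G) H n) ⟩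
  (F 0 ℚ.* G 0 ℚ.+ 0ℚ) ℚ.* H (suc n) ℚ.+ (F 0 ℚ.* ((G ∘ suc) ⊛ H) n ℚ.+ (((F ∘ suc) ⊛ G) ⊛ H) n)
    ≡⟨ cong (λ x → (F 0 ℚ.* G 0 ℚ.+ 0ℚ) ℚ.* H (suc n) ℚ.+ (F 0 ℚ.* ((G ∘ suc) ⊛ H) n ℚ.+ x)) (⊛-assoc (F ∘ suc) G H n) ⟩
  (F 0 ℚ.* G 0 ℚ.+ 0ℚ) ℚ.* H (suc n) ℚ.+ (F 0 ℚ.* ((G ∘ suc) ⊛ H) n ℚ.+ ((F ∘ suc) ⊛ (G ⊛ H)) n)
    ≡⟨ solve 5 (λ f g h x y → (f :* g :+ con 0ℚ) :* h :+ (f :* x :+ y) := f :* (g :* h :+ x) :+ y) refl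
         (F 0) (G 0) (H (suc n)) (((G ∘ suc) ⊛ H) n) (((F ∘ suc) ⊛ (G ⊛ H)) n) ⟩
  (F ⊛ (G ⊛ H)) (suc n) ∎
  where
  open ≡-Reasoning
  open ℚ-Solver

zeros-⊛ : ∀ F n → ((λ _ → 0ℚ) ⊛ F) n ≡ 0ℚ
zeros-⊛ F zero    = cong (ℚ._+ 0ℚ) (ℚ.*-zeroˡ (F 0))
zeros-⊛ F (suc n) = cong₂ ℚ._+_ (ℚ.*-zeroˡ (F (suc n))) (zeros-⊛ F n)

⊛-identityˡ : ∀ F n → (𝟏 ⊛ F) n ≡ F n
⊛-identityˡ F zero    = trans (ℚ.+-identityʳ _) (ℚ.*-identityˡ (F 0))
⊛-identityˡ F (suc n) = trans (cong₂ ℚ._+_ (ℚ.*-identityˡ (F (suc n))) (zeros-⊛ F n)) (ℚ.+-identityʳ _)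

module Inversion (Q : PowerSeries) (Q₀ : Q 0 ≡ ℚ.- 1ℚ) where

  -- Since Q 0 = -1, the inverse X satisfies X (n + 1) = ((Q ∘ suc) ⊛ X) n without division. Each
  -- coefficient needs all earlier ones, hence the fuel k; coefficients below k are final by
  -- `approx-stable`.
  approx : ℕ → PowerSeries
  approx zero    n       = 0ℚ
  approx (suc k) zero    = ℚ.- 1ℚ
  approx (suc k) (suc n) = ((Q ∘ suc) ⊛ approx k) n

  approx-stable : ∀ {k l n} → n < k → n < l → approx k n ≡ approx l n
  approx-stable {n = zero}  (s≤s _)   (s≤s _)   = refl
  approx-stable {n = suc n} (s≤s n<k) (s≤s n<l) = ⊛-congʳ (Q ∘ suc) n λ m m≤n →
    approx-stable (≤-<-trans m≤n n<k) (≤-<-trans m≤n n<l)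

  inverse : PowerSeries
  inverse n = approx (suc n) n

  inverseʳ : ∀ n → (Q ⊛ inverse) n ≡ 𝟏 n
  inverseʳ zero    = cong (λ q → q ℚ.* ℚ.- 1ℚ ℚ.+ 0ℚ) Q₀
  inverseʳ (suc n) = begin
    Q 0 ℚ.* ((Q ∘ suc) ⊛ approx (suc n)) n ℚ.+ ((Q ∘ suc) ⊛ inverse) n
      ≡⟨ cong₂ (λ q x → q ℚ.* ((Q ∘ suc) ⊛ approx (suc n)) n ℚ.+ x) Q₀
           (⊛-congʳ (Q ∘ suc) n λ m m≤n → approx-stable ≤-refl (s≤s m≤n)) ⟩
    ℚ.- 1ℚ ℚ.* ((Q ∘ suc) ⊛ approx (suc n)) n ℚ.+ ((Q ∘ suc) ⊛ approx (suc n)) n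
      ≡⟨ solve 1 (λ x → con (ℚ.- 1ℚ) :* x :+ x := con 0ℚ) refl
           (((Q ∘ suc) ⊛ approx (suc n)) n) ⟩
    0ℚ ∎
    where
    open ≡-Reasoning
    open ℚ-Solver

quotient : ∀ {F P Q} → Q 0 ≡ ℚ.- 1ℚ → Q ⊛ F ≗ P → F ≈ P / Q
quotient {F} {P} {Q} Q₀ QF≗P = inverse , inverseʳ , λ n → begin
  F n                    ≡⟨ ⊛-identityˡ F n ⟨
  (𝟏 ⊛ F) n              ≡⟨ ⊛-comm 𝟏 F n ⟩
  (F ⊛ 𝟏) n              ≡⟨ ⊛-congʳ F n (λ m _ → inverseʳ m) ⟨
  (F ⊛ (Q ⊛ inverse)) n  ≡⟨ ⊛-assoc F Q inverse n ⟨
  ((F ⊛ Q) ⊛ inverse) n  ≡⟨ ⊛-comm (F ⊛ Q) inverse n ⟩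
  (inverse ⊛ (F ⊛ Q)) n  ≡⟨ ⊛-congʳ inverse n (λ m _ → trans (⊛-comm F Q m) (QF≗P m)) ⟩
  (inverse ⊛ P) n        ≡⟨ ⊛-comm inverse P n ⟩
  (P ⊛ inverse) n        ∎
  where
  open ≡-Reasoning
  open Inversion Q Q₀

-- The certificate

value : ℕ → Comb 17 → ℤ
value n = eval ⟪ n * 8 , 0 ⟫

value-blank : ∀ n z → value n (blank 17 z) ≡ z ℤ.* + #tilings n
value-blank n z = eval-blank 17 ⟪ n * 8 , 0 ⟫ z

columns : ℕ → Comb 17 → Comb 17
columns zero    u = u
columns (suc j) u = columns j (column u)

vanishing : ℕ → Comb 17 → Bool
vanishing zero    u = true
vanishing (suc j) u = does (constant u ℤ.≟ 0ℤ) ∧ vanishing j (column u)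

-- Period four reflects the factor x⁴ - 1; four consecutive zero readings then repeat forever,
-- although the combination itself need not vanish.
settled : Comb 17 → Bool
settled u = (columns 4 u == u) ∧ vanishing 4 u

settled-sound : ∀ u → settled u ≡ true → ∀ j → constant (columns j u) ≡ 0ℤ
settled-sound u eq j = go j
  where
  eqs : columns 4 u == u ≡ true × vanishing 4 u ≡ true
  eqs = ∧-true eq
  c₀ : does (constant u ℤ.≟ 0ℤ) ≡ true × vanishing 3 (column u) ≡ true
  c₀ = ∧-true (proj₂ eqs)
  c₁ : does (constant (columns 1 u) ℤ.≟ 0ℤ) ≡ true × vanishing 2 (columns 2 u) ≡ true
  c₁ = ∧-true (proj₂ c₀)
  c₂ : does (constant (columns 2 u) ℤ.≟ 0ℤ) ≡ true × vanishing 1 (columns 3 u) ≡ true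
  c₂ = ∧-true (proj₂ c₁)
  c₃ : does (constant (columns 3 u) ℤ.≟ 0ℤ) ≡ true × vanishing 0 (columns 4 u) ≡ true
  c₃ = ∧-true (proj₂ c₂)
  go : ∀ j → constant (columns j u) ≡ 0ℤ
  go 0 = ≟-sound (proj₁ c₀)
  go 1 = ≟-sound (proj₁ c₁)
  go 2 = ≟-sound (proj₁ c₂)
  go 3 = ≟-sound (proj₁ c₃)
  go (suc (suc (suc (suc j)))) = trans
    (cong (λ v → constant (columns j v)) (==-sound (columns 4 u) u (proj₁ eqs))) (go j)

module Certificate (α β : ℕ → ℤ) where

  -- Shifted by one against the overview: `horner (suc m)` is wₘ, and the sequence starts from
  -- `null`.
  horner : ℕ → Comb 17
  horner zero    = null
  horner (suc m) = column (horner m) ⊞ blank 17 (β m)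

  value-horner-suc : ∀ l m → value l (horner (suc m)) ≡ β m ℤ.* + #tilings l ℤ.+ value (suc l) (horner m)
  value-horner-suc l m = begin
    value l (column (horner m) ⊞ blank 17 (β m))
      ≡⟨ eval-⊞ ⟪ l * 8 , 0 ⟫ (column (horner m)) (blank 17 (β m)) ⟩
    value l (column (horner m)) ℤ.+ value l (blank 17 (β m))
      ≡⟨ cong₂ ℤ._+_ (eval-column (l * 8) (horner m)) (sym (value-blank l (β m))) ⟨
    value (suc l) (horner m) ℤ.+ β m ℤ.* + #tilings l
      ≡⟨ ℤ.+-comm (value (suc l) (horner m)) (β m ℤ.* + #tilings l) ⟩
    β m ℤ.* + #tilings l ℤ.+ value (suc l) (horner m) ∎
    where open ≡-Reasoning

  -- As wₘ = Σ βᵢ Mᵐ⁻ⁱ e, completing it over l more columns gives Σ βᵢ aₘ₋ᵢ₊ₗ. The parameter l makes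
  -- the induction work: splitting off the newest coefficient leaves the older ones with one more
  -- column.
  convolution : ∀ l m → ((ι ∘ β) ⊛ (λ n → ι (+ #tilings (n + l)))) m ≡ ι (value l (horner (suc m)))
  convolution l m = trans (go m l) (trans (sym (ι-+ (β m ℤ.* + #tilings l) (value (suc l) (horner m)))) (cong ι (sym (value-horner-suc l m))))
    where
    open ≡-Reasoning
    go : ∀ m l → ((ι ∘ β) ⊛ (λ n → ι (+ #tilings (n + l)))) m ≡ ι (β m ℤ.* + #tilings l) ℚ.+ ι (value (suc l) (horner m))
    go zero    l = cong (ℚ._+ ι 0ℤ) (sym (ι-* (β 0) (+ #tilings l)))
    go (suc m) l = begin
      ((ι ∘ β) ⊛ (λ n → ι (+ #tilings (n + l)))) (suc m)
        ≡⟨ ⊛-unfoldʳ (ι ∘ β) (λ n → ι (+ #tilings (n + l))) m ⟩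
      ι (β (suc m)) ℚ.* ι (+ #tilings l) ℚ.+ ((ι ∘ β) ⊛ (λ n → ι (+ #tilings (suc n + l)))) m
        ≡⟨ cong₂ ℚ._+_ (sym (ι-* (β (suc m)) (+ #tilings l)))
             (⊛-congʳ (ι ∘ β) m λ n _ → cong (λ i → ι (+ #tilings i)) (sym (+-suc n l))) ⟩
      ι (β (suc m) ℤ.* + #tilings l) ℚ.+ ((ι ∘ β) ⊛ (λ n → ι (+ #tilings (n + suc l)))) m
        ≡⟨ cong (ℚ._+_ (ι (β (suc m) ℤ.* + #tilings l))) (convolution (suc l) m) ⟩
      ι (β (suc m) ℤ.* + #tilings l) ℚ.+ ι (value (suc l) (horner (suc m))) ∎

  -- check′ receives the combination as an argument so that it is evaluated only once.
  check  : ℕ → ℕ → Comb 17 → Bool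
  check′ : ℕ → ℕ → Comb 17 → Bool
  check zero    m u = settled u
  check (suc k) m u = check′ k m (column u ⊞ blank 17 (β m))
  check′ k m u = does (constant u ℤ.≟ ℤ.- α m) ∧ check k (suc m) u

  module _ (K : ℕ) (α-zero : ∀ m → K ≤ m → α m ≡ 0ℤ) (β-zero : ∀ m → K ≤ m → β m ≡ 0ℤ) where

    horner-columns : ∀ j m → K ≤ m → horner (j + m) ≡ columns j (horner m)
    horner-columns zero    m K≤m = refl
    horner-columns (suc j) m K≤m = begin
      horner (suc (j + m))        ≡⟨ cong horner (+-suc j m) ⟨
      horner (j + suc m)          ≡⟨ horner-columns j (suc m) (m≤n⇒m≤1+n K≤m) ⟩
      columns j (horner (suc m))  ≡⟨ cong (columns j) (trans (cong (λ z → column (horner m) ⊞ blank 17 z) (β-zero m K≤m)) (⊞-null (column (horner m)))) ⟩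
      columns (suc j) (horner m)  ∎
      where
      open ≡-Reasoning
      ⊞-null : ∀ {n} (u : Comb n) → u ⊞ null ≡ u
      ⊞-null null       = refl
      ⊞-null (leaf _)   = refl
      ⊞-null (node _ _) = refl

    check-sound : ∀ k m → m + k ≡ K → check k m (horner m) ≡ true →
                  ∀ j → constant (horner (suc (j + m))) ≡ ℤ.- α (j + m)
    check-sound zero m m+0≡K eq j = begin
      constant (horner (suc j + m))            ≡⟨ cong constant (horner-columns (suc j) m K≤m) ⟩
      constant (columns (suc j) (horner m))    ≡⟨ settled-sound (horner m) eq (suc j) ⟩
      0ℤ                                       ≡⟨ cong ℤ.-_ (α-zero (j + m) (≤-trans K≤m (m≤n+m m j))) ⟨
      ℤ.- α (j + m)                            ∎
      where
      open ≡-Reasoning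
      K≤m : K ≤ m
      K≤m = ≤-reflexive (trans (sym m+0≡K) (+-identityʳ m))
    check-sound (suc k) m m+k≡K eq zero    = ≟-sound (proj₁ (∧-true eq))
    check-sound (suc k) m m+k≡K eq (suc j) = subst (λ i → constant (horner (suc i)) ≡ ℤ.- α i) (+-suc j m)
      (check-sound k (suc m) (trans (sym (+-suc m k)) m+k≡K) (proj₂ (∧-true eq)) j)

    product : check K 0 null ≡ true → ∀ m → ((ι ∘ β) ⊛ (ι ∘ +_ ∘ #tilings)) m ≡ ℚ.- ι (α m)
    product eq m = begin
      ((ι ∘ β) ⊛ (ι ∘ +_ ∘ #tilings)) m
        ≡⟨ ⊛-congʳ (ι ∘ β) m (λ n _ → cong (λ i → ι (+ #tilings i)) (sym (+-identityʳ n))) ⟩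
      ((ι ∘ β) ⊛ (λ n → ι (+ #tilings (n + 0)))) m
        ≡⟨ convolution 0 m ⟩
      ι (value 0 (horner (suc m)))
        ≡⟨ cong ι (eval-isEmpty (horner (suc m))) ⟩
      ι (constant (horner (suc m)))
        ≡⟨ cong ι (subst (λ i → constant (horner (suc i)) ≡ ℤ.- α i) (+-identityʳ m) (check-sound K 0 refl eq m)) ⟩
      ι (ℤ.- α m)
        ≡⟨ ι-neg (α m) ⟩
      ℚ.- ι (α m) ∎
      where open ≡-Reasoning

-- For a numeral K the index K + j exposes K successors, so every comparison with a smaller exponent
-- computes and the hypothesis holds by `refl`.
eventually-zero : ∀ (c : ℕ → ℤ) K → (∀ j → c (K + j) ≡ 0ℤ) → ∀ m → K ≤ m → c m ≡ 0ℤ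
eventually-zero c K c-zero m K≤m = trans (cong c (sym (m+[n∸m]≡n K≤m))) (c-zero (m ∸ K))

B⊛F : ⟦ B ⟧ ⊛ generatingFunction #tilings ≗ ⊝ ⟦ A ⟧
-- 69 = 62 + 6 + 1: the degree of B, the factor x⁶, and the index shift of `horner`. The last `refl`
-- runs the whole check.
B⊛F = Certificate.product (coeff A) (coeff B) 69
  (eventually-zero (coeff A) 69 λ _ → refl) (eventually-zero (coeff B) 69 λ _ → refl) refl

generatingFunction-#tilings : generatingFunction #tilings ≈ ⊝ ⟦ A ⟧ / ⟦ B ⟧
generatingFunction-#tilings = quotient {generatingFunction #tilings} {⊝ ⟦ A ⟧} {⟦ B ⟧} refl B⊛F

-- Computes the initial terms with merged frontiers instead of unfolding `count`. The absolute value
-- only changes the type, as `terms-sound` assumes natural values.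
terms : ℕ → Comb 17 → List ℕ
terms zero    u = []
terms (suc n) u = ℤ.∣ constant u ∣ ∷ terms n (column u)

terms-sound : ∀ n g u → (∀ j → value j u ≡ + g j) → terms n u ≡ applyUpTo g n
terms-sound zero    g u eq = refl
terms-sound (suc n) g u eq = cong₂ _∷_
  (cong ℤ.∣_∣ (trans (sym (eval-isEmpty u)) (eq 0)))
  (terms-sound n (g ∘ suc) (column u) λ j → trans (sym (eval-column (j * 8) u)) (eq (suc j)))

terms-16 : terms 16 (blank 17 1ℤ) ≡
  1 ∷ 0 ∷ 1 ∷ 0 ∷ 12 ∷ 2 ∷ 34 ∷ 14 ∷ 250 ∷ 114 ∷ 956 ∷ 694 ∷ 5864 ∷ 4428 ∷ 25805 ∷ 25554 ∷ []
terms-16 = sound refl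
  where
  sound : ∀ {xs ys} → does (List.≡-dec _≟_ xs ys) ≡ true → xs ≡ ys
  sound {xs} {ys} eq with List.≡-dec _≟_ xs ys
  ... | yes xs≡ys = xs≡ys

first-tilings : map #tilings (upTo 16) ≡
  1 ∷ 0 ∷ 1 ∷ 0 ∷ 12 ∷ 2 ∷ 34 ∷ 14 ∷ 250 ∷ 114 ∷ 956 ∷ 694 ∷ 5864 ∷ 4428 ∷ 25805 ∷ 25554 ∷ []
first-tilings = trans (List.map-upTo #tilings 16) (trans (sym (terms-sound 16 #tilings (blank 17 1ℤ)
  λ j → trans (value-blank j 1ℤ) (ℤ.*-identityˡ (+ #tilings j)))) terms-16)

proposition9 : ∃ λ (a : ℕ → ℕ) →
    (∀ n → HasCardinality (tilingSetoid 8 n) (a n)) ×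
    generatingFunction a ≈ ⊝ ⟦ A ⟧ / ⟦ B ⟧ ×
    map a (upTo 16) ≡ 1 ∷ 0 ∷ 1 ∷ 0 ∷ 12 ∷ 2 ∷ 34 ∷ 14 ∷ 250 ∷ 114 ∷ 956 ∷ 694 ∷ 5864 ∷ 4428 ∷ 25805 ∷ 25554 ∷ []
proposition9 = #tilings , cardinality , generatingFunction-#tilings , first-tilings
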